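{- Let $\mathcal{A}$ be a finite list of elements of a finitely generated abelian group $\Gamma$ and let $G$ be a finite abelian group. Then $\#\mathcal{M}(\mathcal{A};\Gamma,G)=\chi^G_{\mathcal{A}}(\#G)$.
   Context: $\mathcal{M}(\mathcal{A};\Gamma,G)=\mathrm{Hom}(\Gamma,G)\smallsetminus\bigcup_{\alpha\in\mathcal{A}}\{\varphi\mid\varphi(\alpha)=0\}$. $r_\Gamma$ is the rank of $\Gamma$, $r_{\mathcal{S}}$ the rank of $\langle\mathcal{S}\rangle$, $m(\mathcal{S};G)=\#\mathrm{Hom}((\Gamma/\langle\mathcal{S}\rangle)_{\mathrm{tor}},G)$ and $\chi^G_{\mathcal{A}}(t)=\sum_{\mathcal{S}\subset\mathcal{A}}(-1)^{\#\mathcal{S}}m(\mathcal{S};G)t^{r_\Gamma-r_{\mathcal{S}}}$ (sublists distinguished by index). -}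

module Defs where

open import Algebra.Bundles using (AbelianGroup)
import Algebra.Definitions.RawMonoid as RawMonoidDefinitions
open import Algebra.Morphism.Bundles using (GroupHomomorphism)
import Algebra.Properties.AbelianGroup as AbelianGroupProperties
import Algebra.Properties.CommutativeMonoid.Mult as CommutativeMultProperties
import Algebra.Properties.Monoid.Mult as MultProperties
open import Data.Fin.Base using (Fin)
open import Data.Fin.Subset using (Subset; _∈_; ∣_∣; inside; outside)
open import Data.Integer.Base as ℤ using (ℤ; +_; -[1+_]; 0ℤ; -1ℤ)
open import Data.Nat.Base as ℕ using (ℕ; suc; _≤_; _∸_; NonZero)
open import Data.Nat.Properties using (m*n≢0)
open import Data.Product.Base using (Σ; ∃; _×_; _,_; proj₁; proj₂)
open import Data.Vec.Base using ([]; _∷_)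
open import Data.Vec.Functional using (Vector)
open import Function.Base using (_∘_)
open import Function.Bundles using (Inverse)
open import Level using (Level; _⊔_)
open import Relation.Binary.Bundles using (Setoid)
open import Relation.Binary.PropositionalEquality.Core using (_≡_)
import Relation.Binary.PropositionalEquality.Properties as ≡
import Relation.Binary.Reasoning.Setoid as ≈-Reasoning
open import Relation.Nullary.Negation.Core using (¬_)
open import Relation.Unary using (Pred)

private
  variable
    a b p ℓ ℓ′ : Level

HasCardinality : Setoid a ℓ → ℕ → Set (a ⊔ ℓ)
HasCardinality X n = Inverse (≡.setoid (Fin n)) X

------------------------------------------------------------------------
-- Subgroups and quotients

record IsSubgroup (Γ : AbelianGroup a ℓ) (P : Pred (AbelianGroup.Carrier Γ) p)
                  : Set (a ⊔ ℓ ⊔ p) where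
  open AbelianGroup Γ
  field
    respects  : ∀ {x y} → x ≈ y → P x → P y
    ε-closed  : P ε
    ∙-closed  : ∀ {x y} → P x → P y → P (x ∙ y)
    ⁻¹-closed : ∀ {x} → P x → P (x ⁻¹)

subgroup : (Γ : AbelianGroup a ℓ) {P : Pred (AbelianGroup.Carrier Γ) p} →
           IsSubgroup Γ P → AbelianGroup (a ⊔ p) ℓ
subgroup Γ {P} isSubgroup = record
  { Carrier = Σ Carrier P
  ; _≈_     = λ x y → proj₁ x ≈ proj₁ y
  ; _∙_     = λ x y → (proj₁ x ∙ proj₁ y) , ∙-closed (proj₂ x) (proj₂ y)
  ; ε       = ε , ε-closed
  ; _⁻¹     = λ x → (proj₁ x ⁻¹) , ⁻¹-closed (proj₂ x)
  ; isAbelianGroup = record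
    { isGroup = record
      { isMonoid = record
        { isSemigroup = record
          { isMagma = record
            { isEquivalence = record { refl = refl ; sym = sym ; trans = trans }
            ; ∙-cong        = ∙-cong
            }
          ; assoc = λ x y z → assoc (proj₁ x) (proj₁ y) (proj₁ z)
          }
        ; identity = (λ x → identityˡ (proj₁ x)) , (λ x → identityʳ (proj₁ x))
        }
      ; inverse = (λ x → inverseˡ (proj₁ x)) , (λ x → inverseʳ (proj₁ x))
      ; ⁻¹-cong = ⁻¹-cong
      }
    ; comm = λ x y → comm (proj₁ x) (proj₁ y)
    }
  }
  where
  open AbelianGroup Γ
  open IsSubgroup isSubgroup

-- Same carrier as Γ, with x and y identified when x ∙ y ⁻¹ lies in P.
quotient : (Γ : AbelianGroup a ℓ) {P : Pred (AbelianGroup.Carrier Γ) p} →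
           IsSubgroup Γ P → AbelianGroup a p
quotient Γ {P} isSubgroup = record
  { Carrier = Carrier
  ; _≈_     = λ x y → P (x ∙ y ⁻¹)
  ; _∙_     = _∙_
  ; ε       = ε
  ; _⁻¹     = _⁻¹
  ; isAbelianGroup = record
    { isGroup = record
      { isMonoid = record
        { isSemigroup = record
          { isMagma = record
            { isEquivalence = record
              { refl  = ≈⇒∼ refl
              ; sym   = λ x∼y → respects lemma-sym (⁻¹-closed x∼y)
              ; trans = λ x∼y y∼z → respects lemma-trans (∙-closed x∼y y∼z)
              }
            ; ∙-cong = λ x∼y u∼v → respects lemma-∙ (∙-closed x∼y u∼v)
            }
          ; assoc = λ x y z → ≈⇒∼ (assoc x y z)
          }
        ; identity = (λ x → ≈⇒∼ (identityˡ x)) , (λ x → ≈⇒∼ (identityʳ x))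
        }
      ; inverse = (λ x → ≈⇒∼ (inverseˡ x)) , (λ x → ≈⇒∼ (inverseʳ x))
      ; ⁻¹-cong = λ x∼y → respects (sym (⁻¹-∙-comm _ _)) (⁻¹-closed x∼y)
      }
    ; comm = λ x y → ≈⇒∼ (comm x y)
    }
  }
  where
  open AbelianGroup Γ
  open AbelianGroupProperties Γ
  open IsSubgroup isSubgroup
  open ≈-Reasoning setoid

  ≈⇒∼ : ∀ {x y} → x ≈ y → P (x ∙ y ⁻¹)
  ≈⇒∼ {x} {y} x≈y = respects (sym (trans (∙-congʳ x≈y) (inverseʳ y))) ε-closed

  lemma-sym : ∀ {x y} → (x ∙ y ⁻¹) ⁻¹ ≈ y ∙ x ⁻¹
  lemma-sym {x} {y} = begin
    (x ∙ y ⁻¹) ⁻¹      ≈⟨ ⁻¹-anti-homo-∙ x (y ⁻¹) ⟩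
    (y ⁻¹) ⁻¹ ∙ x ⁻¹   ≈⟨ ∙-congʳ (⁻¹-involutive y) ⟩
    y ∙ x ⁻¹           ∎

  lemma-trans : ∀ {x y z} → (x ∙ y ⁻¹) ∙ (y ∙ z ⁻¹) ≈ x ∙ z ⁻¹
  lemma-trans {x} {y} {z} = begin
    (x ∙ y ⁻¹) ∙ (y ∙ z ⁻¹)   ≈⟨ assoc x (y ⁻¹) (y ∙ z ⁻¹) ⟩
    x ∙ (y ⁻¹ ∙ (y ∙ z ⁻¹))   ≈⟨ ∙-congˡ (sym (assoc (y ⁻¹) y (z ⁻¹))) ⟩
    x ∙ ((y ⁻¹ ∙ y) ∙ z ⁻¹)   ≈⟨ ∙-congˡ (∙-congʳ (inverseˡ y)) ⟩
    x ∙ (ε ∙ z ⁻¹)            ≈⟨ ∙-congˡ (identityˡ (z ⁻¹)) ⟩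
    x ∙ z ⁻¹                  ∎

  lemma-∙ : ∀ {x y u v} → (x ∙ y ⁻¹) ∙ (u ∙ v ⁻¹) ≈ (x ∙ u) ∙ (y ∙ v) ⁻¹
  lemma-∙ {x} {y} {u} {v} = begin
    (x ∙ y ⁻¹) ∙ (u ∙ v ⁻¹)   ≈⟨ assoc x (y ⁻¹) (u ∙ v ⁻¹) ⟩
    x ∙ (y ⁻¹ ∙ (u ∙ v ⁻¹))   ≈⟨ ∙-congˡ (sym (assoc (y ⁻¹) u (v ⁻¹))) ⟩
    x ∙ ((y ⁻¹ ∙ u) ∙ v ⁻¹)   ≈⟨ ∙-congˡ (∙-congʳ (comm (y ⁻¹) u)) ⟩
    x ∙ ((u ∙ y ⁻¹) ∙ v ⁻¹)   ≈⟨ ∙-congˡ (assoc u (y ⁻¹) (v ⁻¹)) ⟩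
    x ∙ (u ∙ (y ⁻¹ ∙ v ⁻¹))   ≈⟨ sym (assoc x u (y ⁻¹ ∙ v ⁻¹)) ⟩
    (x ∙ u) ∙ (y ⁻¹ ∙ v ⁻¹)   ≈⟨ ∙-congˡ (⁻¹-∙-comm y v) ⟩
    (x ∙ u) ∙ (y ∙ v) ⁻¹      ∎

------------------------------------------------------------------------
-- Generation, torsion and rank

module _ (Γ : AbelianGroup a ℓ) where
  open AbelianGroup Γ
  open AbelianGroupProperties Γ using (⁻¹-∙-comm; ε⁻¹≈ε)
  open RawMonoidDefinitions rawMonoid using (sum) renaming (_×_ to _·_)

  data Generated (P : Pred Carrier p) : Pred Carrier (a ⊔ ℓ ⊔ p) where
    gen  : ∀ {x} → P x → Generated P x
    resp : ∀ {x y} → x ≈ y → Generated P x → Generated P y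
    unit : Generated P ε
    mul  : ∀ {x y} → Generated P x → Generated P y → Generated P (x ∙ y)
    inv  : ∀ {x} → Generated P x → Generated P (x ⁻¹)

  generated-isSubgroup : (P : Pred Carrier p) → IsSubgroup Γ (Generated P)
  generated-isSubgroup P = record
    { respects = resp ; ε-closed = unit ; ∙-closed = mul ; ⁻¹-closed = inv }

  FinitelyGenerated : Set (a ⊔ ℓ)
  FinitelyGenerated =
    ∃ λ k → Σ (Vector Carrier k) λ g → ∀ x → Generated (λ y → ∃ λ i → y ≈ g i) x

  IsTorsion : Pred Carrier ℓ
  IsTorsion x = ∃ λ k → NonZero k × k · x ≈ ε

  torsion-isSubgroup : IsSubgroup Γ IsTorsion
  torsion-isSubgroup = record
    { respects  = λ { x≈y (k , k≢0 , kx≈ε) →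
                      k , k≢0 , trans (×-congʳ k (sym x≈y)) kx≈ε }
    ; ε-closed  = 1 , _ , identityʳ ε
    ; ∙-closed  = λ { {x} {y} (k , k≢0 , kx≈ε) (l , l≢0 , ly≈ε) →
                      l ℕ.* k
                    , m*n≢0 l k {{l≢0}} {{k≢0}}
                    , (begin
                        (l ℕ.* k) · (x ∙ y)
                          ≈⟨ ×-distrib-+ x y (l ℕ.* k) ⟩
                        (l ℕ.* k) · x ∙ (l ℕ.* k) · y
                          ≈⟨ ∙-cong (sym (×-assocˡ x l k)) (×-congˡ {y} (ℕ*-comm l k)) ⟩
                        l · (k · x) ∙ (k ℕ.* l) · y
                          ≈⟨ ∙-cong (×-congʳ l kx≈ε) (sym (×-assocˡ y k l)) ⟩
                        l · ε ∙ k · (l · y)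
                          ≈⟨ ∙-cong (·-ε l) (trans (×-congʳ k ly≈ε) (·-ε k)) ⟩
                        ε ∙ ε
                          ≈⟨ identityˡ ε ⟩
                        ε ∎) }
    ; ⁻¹-closed = λ { {x} (k , k≢0 , kx≈ε) →
                      k , k≢0 , trans (·-⁻¹ k x) (trans (⁻¹-cong kx≈ε) ε⁻¹≈ε) }
    }
    where
    open MultProperties monoid using (×-congʳ; ×-congˡ; ×-assocˡ)
    open CommutativeMultProperties commutativeMonoid using (×-distrib-+)
    open import Data.Nat.Properties using () renaming (*-comm to ℕ*-comm)
    open ≈-Reasoning setoid

    ·-ε : ∀ k → k · ε ≈ ε
    ·-ε ℕ.zero    = refl
    ·-ε (suc k) = trans (identityˡ _) (·-ε k)

    ·-⁻¹ : ∀ k x → k · (x ⁻¹) ≈ (k · x) ⁻¹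
    ·-⁻¹ ℕ.zero    x = sym ε⁻¹≈ε
    ·-⁻¹ (suc k) x = trans (∙-congˡ (·-⁻¹ k x)) (⁻¹-∙-comm x (k · x))

  torsionSubgroup : AbelianGroup (a ⊔ ℓ) ℓ
  torsionSubgroup = subgroup Γ torsion-isSubgroup

  _·ℤ_ : ℤ → Carrier → Carrier
  (+ k)    ·ℤ x = k · x
  -[1+ k ] ·ℤ x = (suc k · x) ⁻¹

  LinearlyIndependent : ∀ {k} → Vector Carrier k → Set ℓ
  LinearlyIndependent {k} v =
    ∀ (c : Vector ℤ k) → sum (λ i → c i ·ℤ v i) ≈ ε → ∀ i → c i ≡ 0ℤ

  -- r is the maximal size of a ℤ-linearly independent family.
  HasRank : ℕ → Set (a ⊔ ℓ)
  HasRank r = (∃ λ (v : Vector Carrier r) → LinearlyIndependent v)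
            × (∀ k (v : Vector Carrier k) → LinearlyIndependent v → k ≤ r)

Hom : AbelianGroup a ℓ → AbelianGroup b ℓ′ → Setoid _ _
Hom Γ G = record
  { Carrier       = GroupHomomorphism Γ.rawGroup G.rawGroup
  ; _≈_           = λ φ ψ → ∀ x → ⟦ φ ⟧ x G.≈ ⟦ ψ ⟧ x
  ; isEquivalence = record
    { refl  = λ _ → G.refl
    ; sym   = λ φ≈ψ x → G.sym (φ≈ψ x)
    ; trans = λ φ≈ψ ψ≈χ x → G.trans (φ≈ψ x) (ψ≈χ x)
    }
  }
  where
  module Γ = AbelianGroup Γ
  module G = AbelianGroup G
  open GroupHomomorphism using (⟦_⟧)

∑⊆ : ∀ {n} → (Subset n → ℤ) → ℤ
∑⊆ {ℕ.zero} f = f []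
∑⊆ {suc n}  f = ∑⊆ (f ∘ (outside ∷_)) ℤ.+ ∑⊆ (f ∘ (inside ∷_))

------------------------------------------------------------------------
-- Arrangements

-- A finite list of n elements of Γ is a vector 𝒜, and a sublist is a set
-- S : Subset n of positions, so repeated entries are distinguished.
module Arrangement (Γ : AbelianGroup a ℓ) (G : AbelianGroup b ℓ′)
                   {n} (𝒜 : Vector (AbelianGroup.Carrier Γ) n) where
  private
    module Γ = AbelianGroup Γ
    module G = AbelianGroup G
  open GroupHomomorphism using (⟦_⟧)

  ℳ : Setoid (a ⊔ ℓ ⊔ b ⊔ ℓ′) (a ⊔ ℓ′)
  ℳ = record
    { Carrier       = Σ (Setoid.Carrier H) λ φ → ¬ (∃ λ i → ⟦ φ ⟧ (𝒜 i) G.≈ G.ε)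
    ; _≈_           = λ φ ψ → Setoid._≈_ H (proj₁ φ) (proj₁ ψ)
    ; isEquivalence = record
      { refl  = λ {φ} → Setoid.refl H {proj₁ φ}
      ; sym   = λ {φ} {ψ} → Setoid.sym H {proj₁ φ} {proj₁ ψ}
      ; trans = λ {φ} {ψ} {χ} → Setoid.trans H {proj₁ φ} {proj₁ ψ} {proj₁ χ}
      }
    }
    where
    H = Hom Γ G

  entries : Subset n → Pred Γ.Carrier ℓ
  entries S x = ∃ λ i → i ∈ S × x Γ.≈ 𝒜 i

  ⟨_⟩ : Subset n → AbelianGroup (a ⊔ ℓ) ℓ
  ⟨ S ⟩ = subgroup Γ (generated-isSubgroup Γ (entries S))

  Γ/⟨_⟩ : Subset n → AbelianGroup a (a ⊔ ℓ)
  Γ/⟨ S ⟩ = quotient Γ (generated-isSubgroup Γ (entries S))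

  -- Ranks and cardinalities are not computable from a general Γ, so the
  -- numbers entering χ are specified by the properties defining them.
  record Invariants : Set (a ⊔ ℓ ⊔ b ⊔ ℓ′) where
    field
      r-Γ   : ℕ
      r     : Subset n → ℕ
      m     : Subset n → ℕ
      r-Γ-rank : HasRank Γ r-Γ
      r-rank   : ∀ S → HasRank ⟨ S ⟩ (r S)
      m-card   : ∀ S → HasCardinality (Hom (torsionSubgroup Γ/⟨ S ⟩) G) (m S)

  χ : Invariants → ℤ → ℤ
  χ I t = ∑⊆ λ S → (-1ℤ ℤ.^ ∣ S ∣) ℤ.* (+ m S) ℤ.* (t ℤ.^ (r-Γ ∸ r S))
    where open Invariants I

{-# OPTIONS --safe #-}
module Submission where

open import Algebra.Bundles using (AbelianGroup)
import Algebra.Definitions.RawMonoid as RawMonoidDefinitions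
open import Algebra.Morphism.Bundles using (GroupHomomorphism)
import Algebra.Properties.AbelianGroup as AbelianGroupProperties
import Algebra.Properties.CommutativeMonoid.Mult as CommutativeMultProperties
import Algebra.Properties.CommutativeMonoid.Sum as SumProperties
import Algebra.Properties.CommutativeSemigroup as CommutativeSemigroupProperties
import Algebra.Properties.Monoid.Mult as MultProperties
import Algebra.Properties.Semiring.Sum as SemiringSum
open import Data.Bool.Base using (Bool; true; false; _∧_; not; if_then_else_)
open import Data.Fin.Base
  using (Fin; zero; suc; _↑ˡ_; _↑ʳ_; punchIn; splitAt; combine; finToFun; funToFin)
open import Data.Fin.Properties
  using ( any?; splitAt⁻¹-↑ˡ; splitAt⁻¹-↑ʳ; *↔×; finToFun-funToFin; funToFin-finToFin
        ; cantor-schröder-bernstein; inj⇒≟; sequence; suc-injective)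
open import Data.Fin.Subset using (Subset; _∈_; ∣_∣; inside; outside)
open import Data.Fin.Subset.Properties using (_∈?_)
open import Data.Integer.Base as ℤ using (ℤ; +_; -[1+_]; 0ℤ; 1ℤ; -1ℤ)
import Data.Integer.DivMod as ℤ÷
import Data.Integer.Properties as ℤₚ
open import Data.Integer.Tactic.RingSolver using (solve-∀)
open import Data.Nat.Base as ℕ using (ℕ; zero; suc; _≤_; _∸_)
open import Data.Nat.Induction using (<-wellFounded)
import Data.Nat.Properties as ℕₚ
open import Data.Product.Base using (Σ; ∃; _×_; _,_; proj₁; proj₂)
open import Data.Product.Function.NonDependent.Setoid using (_×-inverse_)
open import Data.Product.Relation.Binary.Pointwise.NonDependent using (_×ₛ_; Pointwise-≡↔≡)
open import Data.Sum.Base using (_⊎_; inj₁; inj₂; [_,_]′)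
open import Data.Vec.Base using ([]; _∷_; here; there)
open import Data.Vec.Functional using (Vector; insertAt; _++_) renaming (_∷_ to _∷ᵥ_)
open import Data.Vec.Functional.Properties using (insertAt-lookup; insertAt-punchIn; lookup-++ˡ; lookup-++ʳ)
import Data.Vec.Functional.Relation.Binary.Equality.Setoid as VecEquality
open import Effect.Monad using (RawMonad)
open import Function.Base using (_∘_)
open import Function.Bundles using (Inverse; Injection)
import Function.Construct.Composition as Composition
import Function.Construct.Symmetry as Symmetry
open import Function.Definitions using (Injective)
open import Function.Properties.Inverse using (Inverse⇒Injection)
open import Induction.WellFounded using (Acc; acc)
open import Level using (Level; _⊔_)
open import Relation.Binary.Bundles using (Setoid)
open import Relation.Binary.Definitions using (Decidable)
open import Relation.Binary.PropositionalEquality as ≡ using (_≡_; _≢_)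
import Relation.Binary.Reasoning.Setoid as ≈-Reasoning
open import Relation.Nullary using (¬_; Dec; does; yes; no; contradiction; decidable-stable)
open import Relation.Nullary.Decidable using (¬?; ¬¬-excluded-middle; dec-true; dec-false)
open import Relation.Nullary.Negation using (¬¬-Monad; ¬¬-map)
open import Relation.Unary using (Pred)
open import Defs

-- A homomorphism Γ → G vanishing on 𝒮 is a homomorphism Γ/⟨𝒮⟩ → G, so inclusion–exclusion
-- expresses #ℳ through the numbers #Hom(Γ/⟨𝒮⟩, G). A basis of Δ = Γ/⟨𝒮⟩ modulo torsion splits
-- off the torsion subgroup, whence #Hom(Δ, G) = #Hom(Δ_tor, G) · (#G)^s with s its size, and
-- lifting it to Γ next to a basis of ⟨𝒮⟩ modulo torsion gives r_Γ = r_𝒮 + s.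
-- Such bases and the cardinalities exist only up to double negation, which is harmless because
-- equality of integers is stable: a generating family of least size, modulo torsion, is
-- independent, since the Euclidean algorithm turns any relation into a smaller generating family.

-- The hypotheses give no way to decide `≈`, torsion or membership in `⟨ S ⟩` inside `Γ`; only `G`
-- has decidable equality, through its bijection with `Fin q`. All counting is therefore moved to
-- the `G` side. Once `Hom Γ G` is enumerated by some `Fin h`, "homomorphism `i` kills entry `j`" is
-- a Boolean table, and both `ℳ` and every `Hom Γ/⟨ S ⟩ G` become Boolean subsets of the same
-- `Fin h`. Inclusion-exclusion is then a statement about Boolean tables alone. On the `Γ` side,
-- ranks are compared by linear algebra over the rationals with denominators cleared: an element is
-- only ever expressed in a family after multiplication by a nonzero integer, which also absorbs
-- torsion.

-- Integer multiples and integer linear combinations in an abelian group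

module IntegerMultiples {a ℓ : Level} (Γ : AbelianGroup a ℓ) where
  open AbelianGroup Γ
  open AbelianGroupProperties Γ
  open CommutativeSemigroupProperties commutativeSemigroup using (interchange)
  open MultProperties monoid using (×-congʳ; ×-congˡ; ×-homo-+)
  open CommutativeMultProperties commutativeMonoid using (×-distrib-+)
  open SumProperties commutativeMonoid using (sum; sum-cong-≋; ∑-distrib-+; sum-replicate-zero; ∑-comm)
  open RawMonoidDefinitions rawMonoid using () renaming (_×_ to _×ℕ_)
  open ≈-Reasoning setoid

  infixr 8 _·_
  _·_ : ℤ → Carrier → Carrier
  _·_ = _·ℤ_ Γ

  ·-congˡ : ∀ m {x y} → x ≈ y → m · x ≈ m · y
  ·-congˡ (+ k)    x≈y = ×-congʳ k x≈y
  ·-congˡ -[1+ k ] x≈y = ⁻¹-cong (×-congʳ (suc k) x≈y)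

  ·-congʳ : ∀ {m n} x → m ≡ n → m · x ≈ n · x
  ·-congʳ x ≡.refl = refl

  ×-ε : ∀ k → k ×ℕ ε ≈ ε
  ×-ε zero    = refl
  ×-ε (suc k) = trans (identityˡ _) (×-ε k)

  ·-ε : ∀ m → m · ε ≈ ε
  ·-ε (+ k)    = ×-ε k
  ·-ε -[1+ k ] = trans (⁻¹-cong (×-ε (suc k))) ε⁻¹≈ε

  ·-distribˡ : ∀ m x y → m · (x ∙ y) ≈ m · x ∙ m · y
  ·-distribˡ (+ k)    x y = ×-distrib-+ x y k
  ·-distribˡ -[1+ k ] x y =
    trans (⁻¹-cong (×-distrib-+ x y (suc k))) (sym (⁻¹-∙-comm _ _))

  cancelCommon : ∀ x y z → (x ∙ y) ∙ (x ∙ z) ⁻¹ ≈ y ∙ z ⁻¹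
  cancelCommon x y z = begin
    (x ∙ y) ∙ (x ∙ z) ⁻¹     ≈⟨ ∙-congˡ (⁻¹-∙-comm x z) ⟨
    (x ∙ y) ∙ (x ⁻¹ ∙ z ⁻¹)  ≈⟨ interchange x y (x ⁻¹) (z ⁻¹) ⟩
    (x ∙ x ⁻¹) ∙ (y ∙ z ⁻¹)  ≈⟨ ∙-congʳ (inverseʳ x) ⟩
    ε ∙ (y ∙ z ⁻¹)           ≈⟨ identityˡ _ ⟩
    y ∙ z ⁻¹                 ∎

  -- Addition of integers of opposite sign computes to `⊖`, so both mixed cases of `·-distribʳ`
  -- reduce to this one; the recursion strips one common `x` at a time.
  ·-⊖ : ∀ m n x → (m ℤ.⊖ n) · x ≈ (m ×ℕ x) ∙ (n ×ℕ x) ⁻¹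
  ·-⊖ m       zero    x = sym (trans (∙-congˡ ε⁻¹≈ε) (identityʳ _))
  ·-⊖ zero    (suc n) x = sym (identityˡ _)
  ·-⊖ (suc m) (suc n) x = begin
    (suc m ℤ.⊖ suc n) · x              ≈⟨ ·-congʳ x (ℤₚ.[1+m]⊖[1+n]≡m⊖n m n) ⟩
    (m ℤ.⊖ n) · x                      ≈⟨ ·-⊖ m n x ⟩
    (m ×ℕ x) ∙ (n ×ℕ x) ⁻¹             ≈⟨ cancelCommon x (m ×ℕ x) (n ×ℕ x) ⟨
    (suc m ×ℕ x) ∙ (suc n ×ℕ x) ⁻¹     ∎

  ·-distribʳ : ∀ m n x → (m ℤ.+ n) · x ≈ m · x ∙ n · x
  ·-distribʳ (+ m)    (+ n)    x = ×-homo-+ x m n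
  ·-distribʳ (+ m)    -[1+ n ] x = ·-⊖ m (suc n) x
  ·-distribʳ -[1+ m ] (+ n)    x = trans (·-⊖ n (suc m) x) (comm _ _)
  ·-distribʳ -[1+ m ] -[1+ n ] x = begin
    (suc (suc (m ℕ.+ n)) ×ℕ x) ⁻¹         ≈⟨ ⁻¹-cong (×-congˡ (ℕₚ.+-suc (suc m) n)) ⟨
    ((suc m ℕ.+ suc n) ×ℕ x) ⁻¹           ≈⟨ ⁻¹-cong (×-homo-+ x (suc m) (suc n)) ⟩
    ((suc m ×ℕ x) ∙ (suc n ×ℕ x)) ⁻¹      ≈⟨ ⁻¹-∙-comm _ _ ⟨
    (suc m ×ℕ x) ⁻¹ ∙ (suc n ×ℕ x) ⁻¹     ∎

  ·-neg : ∀ m x → (ℤ.- m) · x ≈ (m · x) ⁻¹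
  ·-neg (+ zero)  x = sym ε⁻¹≈ε
  ·-neg (+ suc k) x = refl
  ·-neg -[1+ k ]  x = sym (⁻¹-involutive _)

  ·-⁻¹ : ∀ m x → m · (x ⁻¹) ≈ (m · x) ⁻¹
  ·-⁻¹ m x = inverseˡ-unique _ _ (begin
    m · (x ⁻¹) ∙ m · x   ≈⟨ ·-distribˡ m (x ⁻¹) x ⟨
    m · (x ⁻¹ ∙ x)       ≈⟨ ·-congˡ m (inverseˡ x) ⟩
    m · ε                ≈⟨ ·-ε m ⟩
    ε                    ∎)

  ·-assocℕ : ∀ k n x → (+ k ℤ.* n) · x ≈ k ×ℕ (n · x)
  ·-assocℕ zero    n x = ·-congʳ x (ℤₚ.*-zeroˡ n)
  ·-assocℕ (suc k) n x = begin
    (+ suc k ℤ.* n) · x        ≈⟨ ·-congʳ x (ℤₚ.suc-* (+ k) n) ⟩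
    (n ℤ.+ + k ℤ.* n) · x      ≈⟨ ·-distribʳ n (+ k ℤ.* n) x ⟩
    n · x ∙ (+ k ℤ.* n) · x    ≈⟨ ∙-congˡ (·-assocℕ k n x) ⟩
    n · x ∙ (k ×ℕ (n · x))     ∎

  ·-assoc : ∀ m n x → (m ℤ.* n) · x ≈ m · (n · x)
  ·-assoc (+ k)    n x = ·-assocℕ k n x
  ·-assoc -[1+ k ] n x = begin
    (-[1+ k ] ℤ.* n) · x       ≈⟨ ·-congʳ x (ℤₚ.neg-distribˡ-* (+ suc k) n) ⟨
    (ℤ.- (+ suc k ℤ.* n)) · x  ≈⟨ ·-neg (+ suc k ℤ.* n) x ⟩
    ((+ suc k ℤ.* n) · x) ⁻¹   ≈⟨ ⁻¹-cong (·-assocℕ (suc k) n x) ⟩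
    (suc k ×ℕ (n · x)) ⁻¹      ∎

  lin : ∀ {k} → Vector ℤ k → Vector Carrier k → Carrier
  lin c v = sum (λ i → c i · v i)

  sum-ε : ∀ {k} (v : Vector Carrier k) → (∀ i → v i ≈ ε) → sum v ≈ ε
  sum-ε {k} v v≈ε = trans (sum-cong-≋ v≈ε) (sum-replicate-zero k)

  sum-hom : (f : Carrier → Carrier) → f ε ≈ ε → (∀ x y → f (x ∙ y) ≈ f x ∙ f y) →
            ∀ {k} (v : Vector Carrier k) → f (sum v) ≈ sum (f ∘ v)
  sum-hom f f-ε f-∙ {zero}  v = f-ε
  sum-hom f f-ε f-∙ {suc k} v = trans (f-∙ _ _) (∙-congˡ (sum-hom f f-ε f-∙ (v ∘ suc)))

  lin-cong : ∀ {k} {c d : Vector ℤ k} {v w : Vector Carrier k} →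
             (∀ i → c i ≡ d i) → (∀ i → v i ≈ w i) → lin c v ≈ lin d w
  lin-cong {c = c} {w = w} c≡d v≈w = sum-cong-≋ λ i →
    trans (·-congˡ (c i) (v≈w i)) (·-congʳ (w i) (c≡d i))

  lin-0 : ∀ {k} (c : Vector ℤ k) v → (∀ i → c i ≡ 0ℤ) → lin c v ≈ ε
  lin-0 c v c≡0 = sum-ε _ λ i → ·-congʳ (v i) (c≡0 i)

  lin-+ : ∀ {k} (c d : Vector ℤ k) v → lin (λ i → c i ℤ.+ d i) v ≈ lin c v ∙ lin d v
  lin-+ c d v = trans (sum-cong-≋ λ i → ·-distribʳ (c i) (d i) (v i))
                      (∑-distrib-+ (λ i → c i · v i) (λ i → d i · v i))

  lin-· : ∀ {k} m (c : Vector ℤ k) v → lin (λ i → m ℤ.* c i) v ≈ m · lin c v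
  lin-· m c v = trans (sum-cong-≋ λ i → ·-assoc m (c i) (v i))
                      (sym (sum-hom (m ·_) (·-ε m) (·-distribˡ m) (λ i → c i · v i)))

  lin-neg : ∀ {k} (c : Vector ℤ k) v → lin (λ i → ℤ.- c i) v ≈ (lin c v) ⁻¹
  lin-neg c v = trans (sum-cong-≋ λ i → ·-neg (c i) (v i))
                      (sym (sum-hom _⁻¹ ε⁻¹≈ε (λ x y → sym (⁻¹-∙-comm x y)) (λ i → c i · v i)))

  -- Exchanging the two sums turns a combination of combinations into a vector-matrix product. A
  -- left kernel vector of the coefficient matrix thus becomes a relation.
  lin-lin : ∀ {k m} (c : Vector ℤ k) (A : Fin k → Vector ℤ m) v →
            lin c (λ i → lin (A i) v) ≈
            lin (λ j → SumProperties.sum ℤₚ.+-0-commutativeMonoid (λ i → c i ℤ.* A i j)) v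
  lin-lin c A v = begin
    lin c (λ i → lin (A i) v)
      ≈⟨ sum-cong-≋ (λ i → lin-· (c i) (A i) v) ⟨
    sum (λ i → sum (λ j → (c i ℤ.* A i j) · v j))
      ≈⟨ ∑-comm (λ i j → (c i ℤ.* A i j) · v j) ⟩
    sum (λ j → sum (λ i → (c i ℤ.* A i j) · v j))
      ≈⟨ sum-cong-≋ (λ j → sum-· (λ i → c i ℤ.* A i j) (v j)) ⟨
    lin (λ j → SumProperties.sum ℤₚ.+-0-commutativeMonoid (λ i → c i ℤ.* A i j)) v ∎
    where
    sum-· : ∀ {k} (d : Vector ℤ k) x →
            SumProperties.sum ℤₚ.+-0-commutativeMonoid d · x ≈ sum (λ i → d i · x)
    sum-· {zero}  d x = refl
    sum-· {suc k} d x = trans (·-distribʳ (d zero) _ x) (∙-congˡ (sum-· (d ∘ suc) x))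

  sum-split : ∀ m {n} (v : Vector Carrier (m ℕ.+ n)) →
              sum v ≈ sum (λ i → v (i ↑ˡ n)) ∙ sum (λ i → v (m ↑ʳ i))
  sum-split zero    v = sym (identityˡ _)
  sum-split (suc m) v = trans (∙-congˡ (sum-split m (v ∘ suc))) (sym (assoc _ _ _))

  module _ {p} {P : Carrier → Set p} (isSubgroup : IsSubgroup Γ P) where
    open IsSubgroup isSubgroup

    ×∈subgroup : ∀ k {x} → P x → P (k ×ℕ x)
    ×∈subgroup zero    Px = ε-closed
    ×∈subgroup (suc k) Px = ∙-closed Px (×∈subgroup k Px)

    ·∈subgroup : ∀ m {x} → P x → P (m · x)
    ·∈subgroup (+ k)    Px = ×∈subgroup k Px
    ·∈subgroup -[1+ k ] Px = ⁻¹-closed (×∈subgroup (suc k) Px)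

    lin∈subgroup : ∀ {k} (c : Vector ℤ k) v → (∀ i → P (v i)) → P (lin c v)
    lin∈subgroup {zero}  c v Pv = ε-closed
    lin∈subgroup {suc k} c v Pv =
      ∙-closed (·∈subgroup (c zero) (Pv zero)) (lin∈subgroup (c ∘ suc) (v ∘ suc) (Pv ∘ suc))

module _ {a b ℓ ℓ′ : Level} (Γ : AbelianGroup a ℓ) (Δ : AbelianGroup b ℓ′)
         (φ : GroupHomomorphism (AbelianGroup.rawGroup Γ) (AbelianGroup.rawGroup Δ)) where
  private
    module Γ = AbelianGroup Γ
    module Γᵐ = IntegerMultiples Γ
  open AbelianGroup Δ
  open IntegerMultiples Δ
  open GroupHomomorphism φ
  open RawMonoidDefinitions rawMonoid using () renaming (_×_ to _×ℕ_)
  open RawMonoidDefinitions Γ.rawMonoid using () renaming (_×_ to _×ᴳ_)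

  ×-homo : ∀ k x → ⟦ k ×ᴳ x ⟧ ≈ k ×ℕ ⟦ x ⟧
  ×-homo zero    x = ε-homo
  ×-homo (suc k) x = trans (homo _ _) (∙-congˡ (×-homo k x))

  ·-homo : ∀ m x → ⟦ m Γᵐ.· x ⟧ ≈ m · ⟦ x ⟧
  ·-homo (+ k)    x = ×-homo k x
  ·-homo -[1+ k ] x = trans (⁻¹-homo _) (⁻¹-cong (×-homo (suc k) x))

  lin-homo : ∀ {k} (c : Vector ℤ k) v → ⟦ Γᵐ.lin c v ⟧ ≈ lin c (⟦_⟧ ∘ v)
  lin-homo {zero}  c v = ε-homo
  lin-homo {suc k} c v =
    trans (homo _ _) (∙-cong (·-homo (c zero) (v zero)) (lin-homo (c ∘ suc) (v ∘ suc)))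

-- The operations of a quotient are those of Γ, but stuck applications of _·ℤ_ and sum over
-- the two groups do not unify.
module _ {a ℓ p : Level} (Γ : AbelianGroup a ℓ) {P : AbelianGroup.Carrier Γ → Set p}
         (H : IsSubgroup Γ P) where
  private
    module Γᵐ = IntegerMultiples Γ
    module Qᵐ = IntegerMultiples (quotient Γ H)
  open AbelianGroup Γ using (Carrier; _∙_; _⁻¹; rawMonoid)
  open RawMonoidDefinitions rawMonoid using () renaming (_×_ to _×ℕ_)
  open RawMonoidDefinitions (AbelianGroup.rawMonoid (quotient Γ H)) using () renaming (_×_ to _×Q_)

  quotient-× : ∀ k x → k ×Q x ≡ k ×ℕ x
  quotient-× zero    x = ≡.refl
  quotient-× (suc k) x = ≡.cong (x ∙_) (quotient-× k x)

  quotient-· : ∀ m x → m Qᵐ.· x ≡ m Γᵐ.· x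
  quotient-· (+ k)    x = quotient-× k x
  quotient-· -[1+ k ] x = ≡.cong _⁻¹ (quotient-× (suc k) x)

  quotient-lin : ∀ {k} (c : Vector ℤ k) v → Qᵐ.lin c v ≡ Γᵐ.lin c v
  quotient-lin {zero}  c v = ≡.refl
  quotient-lin {suc k} c v =
    ≡.cong₂ _∙_ (quotient-· (c zero) (v zero)) (quotient-lin (c ∘ suc) (v ∘ suc))

-- Fraction-free elimination over the integers

open SemiringSum ℤₚ.+-*-semiring using ()
  renaming ( sum to sumℤ; sum-cong-≗ to sumℤ-cong; sum-remove to sumℤ-remove; ∑-distrib-+ to sumℤ-+
           ; *-distribʳ-sum to sumℤ-*ʳ; sum-replicate-zero to sumℤ-replicate-zero)

sumℤ-0 : ∀ {k} (f : Vector ℤ k) → (∀ i → f i ≡ 0ℤ) → sumℤ f ≡ 0ℤ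
sumℤ-0 {k} f f≡0 = ≡.trans (sumℤ-cong f≡0) (sumℤ-replicate-zero k)

*-≢0 : ∀ {m n} → m ≢ 0ℤ → n ≢ 0ℤ → m ℤ.* n ≢ 0ℤ
*-≢0 {m} m≢0 n≢0 mn≡0 = [ m≢0 , n≢0 ]′ (ℤₚ.i*j≡0⇒i≡0∨j≡0 m mn≡0)

-- Gaussian elimination without division. If the first column is zero it is dropped. Otherwise a row
-- `p` with nonzero first entry is the pivot, and every other row is replaced by pivot entry times
-- that row minus its own first entry times row `p`, which clears the first column and removes one
-- row and one column.
leftKernel : ∀ m {k} (A : Fin k → Fin m → ℤ) → m ℕ.< k →
             ∃ λ (c : Vector ℤ k) → (∃ λ i → c i ≢ 0ℤ) × ∀ j → sumℤ (λ i → c i ℤ.* A i j) ≡ 0ℤ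
leftKernel zero {suc k} A _ = (λ _ → 1ℤ) , (zero , λ ()) , λ ()
leftKernel (suc m) {suc k} A m<k with any? (λ i → ¬? (A i zero ℤₚ.≟ 0ℤ))
... | no column≡0 = c , c≢0 , λ
  { zero    → sumℤ-0 _ λ i → ≡.trans (≡.cong (c i ℤ.*_) (A₀≡0 i)) (ℤₚ.*-zeroʳ (c i))
  ; (suc j) → c-kernel j }
  where
  A₀≡0 : ∀ i → A i zero ≡ 0ℤ
  A₀≡0 i = decidable-stable (A i zero ℤₚ.≟ 0ℤ) λ A₀≢0 → column≡0 (i , A₀≢0)
  rest = leftKernel m (λ i j → A i (suc j)) (ℕₚ.<-trans (ℕₚ.n<1+n m) m<k)
  c        = proj₁ rest
  c≢0      = proj₁ (proj₂ rest)
  c-kernel = proj₂ (proj₂ rest)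
... | yes (p , Ap≢0) = c , c≢0 , c-kernel
  where
  A′ : Fin k → Fin (suc m) → ℤ
  A′ i = A (punchIn p i)
  rest = leftKernel m (λ i j → A p zero ℤ.* A′ i (suc j) ℤ.- A′ i zero ℤ.* A p (suc j))
                      (ℕₚ.≤-pred m<k)
  d = proj₁ rest
  -- Unfolding the eliminated rows in the combination `d`, each original row `i` occurs
  -- `A p zero ℤ.* d i` times, and `cp` collects the multiples of the pivot row that were
  -- subtracted.
  cp = sumℤ (λ i → d i ℤ.* (ℤ.- A′ i zero))
  c′ : Vector ℤ k
  c′ i = A p zero ℤ.* d i
  c = insertAt c′ p cp

  c≢0 : ∃ λ i → c i ≢ 0ℤ
  c≢0 with proj₁ (proj₂ rest)
  ... | i , di≢0 = punchIn p i , λ ci≡0 →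
    *-≢0 Ap≢0 di≢0 (≡.trans (≡.sym (insertAt-punchIn c′ p cp i)) ci≡0)

  regroup : ∀ x a e y b → (x ℤ.* (ℤ.- a)) ℤ.* e ℤ.+ (y ℤ.* x) ℤ.* b ≡ x ℤ.* (y ℤ.* b ℤ.- a ℤ.* e)
  regroup = solve-∀

  eliminated : ∀ j → sumℤ (λ i → c i ℤ.* A i j) ≡
                     sumℤ (λ i → d i ℤ.* (A p zero ℤ.* A′ i j ℤ.- A′ i zero ℤ.* A p j))
  eliminated j = begin
    sumℤ (λ i → c i ℤ.* A i j)
      ≡⟨ sumℤ-remove {i = p} (λ i → c i ℤ.* A i j) ⟩
    c p ℤ.* A p j ℤ.+ sumℤ (λ i → c (punchIn p i) ℤ.* A′ i j)
      ≡⟨ ≡.cong₂ ℤ._+_ (≡.cong (ℤ._* A p j) (insertAt-lookup c′ p cp))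
                       (sumℤ-cong λ i → ≡.cong (ℤ._* A′ i j) (insertAt-punchIn c′ p cp i)) ⟩
    cp ℤ.* A p j ℤ.+ sumℤ (λ i → c′ i ℤ.* A′ i j)
      ≡⟨ ≡.cong (ℤ._+ sumℤ (λ i → c′ i ℤ.* A′ i j)) (sumℤ-*ʳ (A p j) (λ i → d i ℤ.* (ℤ.- A′ i zero))) ⟩
    sumℤ (λ i → d i ℤ.* (ℤ.- A′ i zero) ℤ.* A p j) ℤ.+ sumℤ (λ i → c′ i ℤ.* A′ i j)
      ≡⟨ sumℤ-+ (λ i → d i ℤ.* (ℤ.- A′ i zero) ℤ.* A p j) (λ i → c′ i ℤ.* A′ i j) ⟨
    sumℤ (λ i → d i ℤ.* (ℤ.- A′ i zero) ℤ.* A p j ℤ.+ c′ i ℤ.* A′ i j)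
      ≡⟨ sumℤ-cong (λ i → regroup (d i) (A′ i zero) (A p j) (A p zero) (A′ i j)) ⟩
    sumℤ (λ i → d i ℤ.* (A p zero ℤ.* A′ i j ℤ.- A′ i zero ℤ.* A p j)) ∎
    where open ≡.≡-Reasoning

  cancel : ∀ x y z → x ℤ.* (y ℤ.* z ℤ.- z ℤ.* y) ≡ 0ℤ
  cancel = solve-∀

  c-kernel : ∀ j → sumℤ (λ i → c i ℤ.* A i j) ≡ 0ℤ
  c-kernel zero    = ≡.trans (eliminated zero) (sumℤ-0 _ λ i → cancel (d i) (A p zero) (A′ i zero))
  c-kernel (suc j) = ≡.trans (eliminated (suc j)) (proj₂ (proj₂ rest) j)

-- Generating families, the Euclidean reduction and independence

module Generation {a ℓ : Level} (Γ : AbelianGroup a ℓ) where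
  open AbelianGroup Γ
  open AbelianGroupProperties Γ
  open IntegerMultiples Γ
  open ≈-Reasoning setoid

  generated-⊆ : ∀ {p q} {P : Pred Carrier p} {Q : Pred Carrier q} →
                (∀ {x} → P x → Generated Γ Q x) → ∀ {x} → Generated Γ P x → Generated Γ Q x
  generated-⊆ P⊆Q (gen Px)    = P⊆Q Px
  generated-⊆ P⊆Q (resp eq g) = resp eq (generated-⊆ P⊆Q g)
  generated-⊆ P⊆Q unit        = unit
  generated-⊆ P⊆Q (mul g h)   = mul (generated-⊆ P⊆Q g) (generated-⊆ P⊆Q h)
  generated-⊆ P⊆Q (inv g)     = inv (generated-⊆ P⊆Q g)

  InRange : ∀ {k} → Vector Carrier k → Pred Carrier ℓ
  InRange v y = ∃ λ i → y ≈ v i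

  Generates : ∀ {k} → Vector Carrier k → Set (a ⊔ ℓ)
  Generates v = ∀ x → Generated Γ (InRange v) x

  unitVector : ∀ {k} → Fin k → Vector ℤ k
  unitVector zero    zero    = 1ℤ
  unitVector zero    (suc j) = 0ℤ
  unitVector (suc i) zero    = 0ℤ
  unitVector (suc i) (suc j) = unitVector i j

  lin-unitVector : ∀ {k} (i : Fin k) v → lin (unitVector i) v ≈ v i
  lin-unitVector zero    v =
    trans (∙-cong (identityʳ _) (lin-0 (unitVector zero ∘ suc) (v ∘ suc) λ _ → ≡.refl)) (identityʳ _)
  lin-unitVector (suc i) v = trans (identityˡ _) (lin-unitVector i (v ∘ suc))

  generated⇒lin : ∀ {k} (v : Vector Carrier k) {x} → Generated Γ (InRange v) x → ∃ λ c → x ≈ lin c v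
  generated⇒lin v (gen (i , x≈vi)) = unitVector i , trans x≈vi (sym (lin-unitVector i v))
  generated⇒lin v (resp x≈y g) = let c , x≈ = generated⇒lin v g in c , trans (sym x≈y) x≈
  generated⇒lin v unit         = (λ _ → 0ℤ) , sym (lin-0 _ v λ _ → ≡.refl)
  generated⇒lin v (mul g h)    =
    let c , x≈ = generated⇒lin v g ; d , y≈ = generated⇒lin v h
    in  (λ i → c i ℤ.+ d i) , trans (∙-cong x≈ y≈) (sym (lin-+ c d v))
  generated⇒lin v (inv g)      =
    let c , x≈ = generated⇒lin v g in (λ i → ℤ.- c i) , trans (⁻¹-cong x≈) (sym (lin-neg c v))

  TorsionFree : Set (a ⊔ ℓ)
  TorsionFree = ∀ m x → m ≢ 0ℤ → m · x ≈ ε → x ≈ ε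

  -- The Euclidean algorithm on (α , β): g is their gcd up to sign, and (w , z) is obtained from
  -- (x , y) by a unimodular substitution.
  euclid : ∀ α β x y → Acc ℕ._<_ ℤ.∣ β ∣ →
           ∃ λ g → ∃ λ w → ∃ λ z →
             g · z ≈ α · x ∙ β · y × (g ≡ 0ℤ → α ≡ 0ℤ × β ≡ 0ℤ) ×
             Generated Γ (λ u → u ≈ w ⊎ u ≈ z) x × Generated Γ (λ u → u ≈ w ⊎ u ≈ z) y
  euclid α β x y (acc rs) with β ℤₚ.≟ 0ℤ
  ... | yes ≡.refl = α , y , x , sym (identityʳ _) , (λ α≡0 → α≡0 , ≡.refl) ,
                     gen (inj₂ refl) , gen (inj₁ refl)
  ... | no β≢0 =
    -- Writing `α` as `ρ ℤ.+ κ ℤ.* β` regroups the combination as `β` times `κ · x ∙ y` plus `ρ`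
    -- times `x`. Here `β` is nonzero, so the resulting `g` is too, and `y` is recovered from
    -- `κ · x ∙ y` by removing `κ · x`.
    let g , w , z , gz≈ , g≡0⇒ , κx∙y∈ , x∈ = euclid β ρ (κ · x ∙ y) x (rs (ℤ÷.n%d<d α β))
    in  g , w , z , trans gz≈ step , (λ g≡0 → contradiction (proj₁ (g≡0⇒ g≡0)) β≢0) , x∈ ,
        resp (trans (sym (assoc _ _ _)) (trans (∙-congʳ (inverseˡ _)) (identityˡ y)))
             (mul (inv (·∈subgroup (generated-isSubgroup Γ _) κ x∈)) κx∙y∈)
    where
    instance _ = ℤ.≢-nonZero β≢0
    ρ κ : ℤ
    ρ = + (α ℤ÷.% β)
    κ = α ℤ÷./ β

    step : β · (κ · x ∙ y) ∙ ρ · x ≈ α · x ∙ β · y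
    step = begin
      β · (κ · x ∙ y) ∙ ρ · x              ≈⟨ ∙-congʳ (·-distribˡ β (κ · x) y) ⟩
      (β · κ · x ∙ β · y) ∙ ρ · x          ≈⟨ comm _ _ ⟩
      ρ · x ∙ (β · κ · x ∙ β · y)          ≈⟨ assoc _ _ _ ⟨
      (ρ · x ∙ β · κ · x) ∙ β · y          ≈⟨ ∙-congʳ (∙-congˡ (·-assoc β κ x)) ⟨
      (ρ · x ∙ (β ℤ.* κ) · x) ∙ β · y      ≈⟨ ∙-congʳ (∙-congˡ (·-congʳ x (ℤₚ.*-comm β κ))) ⟩
      (ρ · x ∙ (κ ℤ.* β) · x) ∙ β · y      ≈⟨ ∙-congʳ (·-distribʳ ρ (κ ℤ.* β) x) ⟨
      (ρ ℤ.+ κ ℤ.* β) · x ∙ β · y          ≈⟨ ∙-congʳ (·-congʳ x (ℤ÷.a≡a%n+[a/n]*n α β)) ⟨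
      α · x ∙ β · y                        ∎

  -- `euclid` trades the first two vectors for `w` and `z` so that the relation involves only `z`
  -- and the remaining vectors, and stays nontrivial because `g` vanishes only if both old
  -- coefficients do. Recursion saves one vector among these, and `w` is put back.
  dependent⇒fewer : TorsionFree → ∀ {s} (b : Vector Carrier (suc s)) c → (∃ λ i → c i ≢ 0ℤ) →
                    lin c b ≈ ε → ∃ λ (b′ : Vector Carrier s) → ∀ i → Generated Γ (InRange b′) (b i)
  dependent⇒fewer tf {zero} b c (zero , c₀≢0) rel =
    -- A single vector with a vanishing nonzero multiple is trivial by torsion-freeness, so the
    -- empty family generates it.
    (λ ()) , λ { zero → resp (sym (tf (c zero) (b zero) c₀≢0 (trans (sym (identityʳ _)) rel))) unit }
  dependent⇒fewer tf {suc s} b c c≢0 rel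
    with euclid (c zero) (c (suc zero)) (b zero) (b (suc zero)) (<-wellFounded _)
  ... | g , w , z , gz≈ , g≡0⇒ , x∈ , y∈ = w ∷ᵥ b′ , λ
    { zero          → generated-⊆ wz∈ x∈
    ; (suc zero)    → generated-⊆ wz∈ y∈
    ; (suc (suc i)) → weaken (b∈ (suc i)) }
    where
    nonzero : (∃ λ i → c i ≢ 0ℤ) → ∃ λ i → (g ∷ᵥ (λ i → c (suc (suc i)))) i ≢ 0ℤ
    nonzero (zero        , c≢0) = zero , λ g≡0 → c≢0 (proj₁ (g≡0⇒ g≡0))
    nonzero (suc zero    , c≢0) = zero , λ g≡0 → c≢0 (proj₂ (g≡0⇒ g≡0))
    nonzero (suc (suc i) , c≢0) = suc i , c≢0
    rec = dependent⇒fewer tf (z ∷ᵥ (λ i → b (suc (suc i)))) (g ∷ᵥ (λ i → c (suc (suc i))))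
            (nonzero c≢0) (trans (∙-congʳ gz≈) (trans (assoc _ _ _) rel))
    b′ = proj₁ rec
    b∈ = proj₂ rec
    weaken : ∀ {x} → Generated Γ (InRange b′) x → Generated Γ (InRange (w ∷ᵥ b′)) x
    weaken = generated-⊆ λ (i , x≈) → gen (suc i , x≈)
    wz∈ : ∀ {u} → u ≈ w ⊎ u ≈ z → Generated Γ (InRange (w ∷ᵥ b′)) u
    wz∈ (inj₁ u≈w) = gen (zero , u≈w)
    wz∈ (inj₂ u≈z) = resp (sym u≈z) (weaken (b∈ zero))

  -- Induction on the size, with `none` assumed throughout. The family at hand is then itself
  -- independent: a nonzero coefficient in a relation would yield a smaller generating family, which
  -- the induction refutes. Independence only asserts integer equalities, so this argument by
  -- contradiction is constructive.
  independentGenerators : TorsionFree → ∀ {k} (b : Vector Carrier k) → Generates b →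
    ¬ ¬ (∃ λ s → ∃ λ (b′ : Vector Carrier s) → Generates b′ × LinearlyIndependent Γ b′)
  independentGenerators tf {zero}  b b-gen none = none (zero , b , b-gen , λ _ _ ())
  independentGenerators tf {suc k} b b-gen none = none (suc k , b , b-gen , λ c rel i →
    decidable-stable (c i ℤₚ.≟ 0ℤ) λ ci≢0 →
      let b′ , b∈ = dependent⇒fewer tf b c (i , ci≢0) rel
      in  independentGenerators tf b′
            (λ x → generated-⊆ (λ (j , y≈) → resp (sym y≈) (b∈ j)) (b-gen x)) none)

  ·≈ε⇒torsion : ∀ m {x} → m ≢ 0ℤ → m · x ≈ ε → IsTorsion Γ x
  ·≈ε⇒torsion (+ zero)  m≢0 _  = contradiction ≡.refl m≢0
  ·≈ε⇒torsion (+ suc k) _   eq = suc k , _ , eq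
  ·≈ε⇒torsion -[1+ k ]  _   eq = suc k , _ , ⁻¹-injective (trans eq (sym ε⁻¹≈ε))

  ≈ε⇒torsion : ∀ {x} → x ≈ ε → IsTorsion Γ x
  ≈ε⇒torsion x≈ε = 1 , _ , trans (identityʳ _) x≈ε

  torsion⇒·≈ε : ∀ {x} → IsTorsion Γ x → ∃ λ m → m ≢ 0ℤ × m · x ≈ ε
  torsion⇒·≈ε (suc k , _ , eq) = + suc k , (λ ()) , eq

  -- If `k` exceeded `m`, the coefficient matrix would have a nonzero left kernel vector `c`, and
  -- the products of `c i` with the nonzero multiplier of `v i` would form a nontrivial relation on
  -- `v`.
  lin-size-≤ : ∀ {k m} (v : Vector Carrier k) (w : Vector Carrier m) → LinearlyIndependent Γ v →
               (∀ i → ∃ λ N → N ≢ 0ℤ × ∃ λ c → N · v i ≈ lin c w) → k ≤ m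
  lin-size-≤ {k} {m} v w v-indep spans = ℕₚ.≮⇒≥ λ m<k →
    let c , (i , ci≢0) , c-kernel = leftKernel m A m<k
    in  *-≢0 ci≢0 (N≢0 i) (v-indep (λ i → c i ℤ.* N i) (begin
          lin (λ i → c i ℤ.* N i) v            ≈⟨ sum-cong-≋ (λ i → ·-assoc (c i) (N i) (v i)) ⟩
          lin c (λ i → N i · v i)              ≈⟨ lin-cong {c = c} (λ _ → ≡.refl) (λ i → proj₂ (proj₂ (proj₂ (spans i)))) ⟩
          lin c (λ i → lin (A i) w)            ≈⟨ lin-lin c A w ⟩
          lin (λ j → sumℤ (λ i → c i ℤ.* A i j)) w  ≈⟨ lin-0 _ w c-kernel ⟩
          ε                                    ∎) i)
    where
    open SumProperties commutativeMonoid using (sum-cong-≋)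
    N   = λ i → proj₁ (spans i)
    N≢0 = λ i → proj₁ (proj₂ (spans i))
    A   = λ i → proj₁ (proj₂ (proj₂ (spans i)))

  hasRank-unique : ∀ {r s} → HasRank Γ r → HasRank Γ s → r ≡ s
  hasRank-unique ((v , v-indep) , r-max) ((w , w-indep) , s-max) =
    ℕₚ.≤-antisym (s-max _ v v-indep) (r-max _ w w-indep)

-- Bases modulo torsion and the rank

-- Everything is phrased with elements of `Γ` itself, so that the basis can be lifted and evaluated
-- directly. `coef` is a bare function: that it respects `≈` and is additive follows later from
-- `independent`, by uniqueness of coordinates.
record BasisModTorsion {a ℓ : Level} (Γ : AbelianGroup a ℓ) : Set (a ⊔ ℓ) where
  open AbelianGroup Γ
  open IntegerMultiples Γ
  field
    {size}      : ℕ
    vec         : Vector Carrier size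
    coef        : Carrier → Vector ℤ size
    spans       : ∀ x → IsTorsion Γ (x ∙ lin (coef x) vec ⁻¹)
    independent : ∀ c → IsTorsion Γ (lin c vec) → ∀ i → c i ≡ 0ℤ

module _ {a ℓ : Level} (Γ : AbelianGroup a ℓ) where
  open AbelianGroup Γ
  open AbelianGroupProperties Γ
  open IntegerMultiples Γ
  open Generation Γ
  open ≈-Reasoning setoid

  -- Being trivial in a quotient unfolds to membership of `x ∙ ε ⁻¹` in the subgroup; this removes
  -- the spurious factor.
  x∙ε⁻¹≈x : ∀ {x} → x ∙ ε ⁻¹ ≈ x
  x∙ε⁻¹≈x = trans (∙-congˡ ε⁻¹≈ε) (identityʳ _)

  generated-quotient : ∀ {p} {P : Pred Carrier p} (H : IsSubgroup Γ P) {k} {v : Vector Carrier k} {x} →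
                       Generated Γ (InRange v) x →
                       Generated (quotient Γ H) (Generation.InRange (quotient Γ H) v) x
  generated-quotient {P = P} H = go
    where
    open IsSubgroup H
    lift : ∀ {x y} → x ≈ y → P (x ∙ y ⁻¹)
    lift x≈y = respects (sym (x≈y⇒x∙y⁻¹≈ε x≈y)) ε-closed
    go : ∀ {k} {v : Vector Carrier k} {x} → Generated Γ (InRange v) x →
         Generated (quotient Γ H) (Generation.InRange (quotient Γ H) v) x
    go (gen (i , x≈)) = gen (i , lift x≈)
    go (resp x≈y g)   = resp (lift x≈y) (go g)
    go unit           = unit
    go (mul g h)      = mul (go g) (go h)
    go (inv g)        = inv (go g)

  quotient-finitelyGenerated : ∀ {p} {P : Pred Carrier p} (H : IsSubgroup Γ P) →
                               FinitelyGenerated Γ → FinitelyGenerated (quotient Γ H)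
  quotient-finitelyGenerated H (k , v , v-gen) = k , v , λ x → generated-quotient H (v-gen x)

  private
    torsionSub = torsion-isSubgroup Γ
    F = quotient Γ torsionSub
    module T = IsSubgroup torsionSub

  Γ/torsion-torsionFree : Generation.TorsionFree F
  Γ/torsion-torsionFree m x m≢0 mx-torsion =
    let n , n≢0 , nmx≈ε = torsion⇒·≈ε
          (≡.subst (IsTorsion Γ) (quotient-· Γ torsionSub m x) (T.respects x∙ε⁻¹≈x mx-torsion))
    in  T.respects (sym x∙ε⁻¹≈x)
          (·≈ε⇒torsion (n ℤ.* m) (*-≢0 n≢0 m≢0) (trans (·-assoc n m x) nmx≈ε))

  -- The quotient by torsion keeps the carrier of `Γ`, so independent generators of it are already
  -- elements of `Γ`, and its equality unfolds to the torsion conditions of `spans` and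
  -- `independent`.
  basis-exists : FinitelyGenerated Γ → ¬ ¬ BasisModTorsion Γ
  basis-exists fg none =
    let k , v , v-gen = quotient-finitelyGenerated torsionSub fg
    in  Generation.independentGenerators F Γ/torsion-torsionFree v v-gen λ (s , b , b-gen , b-indep) →
          let x≈lin = λ x → Generation.generated⇒lin F b (b-gen x)
          in  none record
            { vec         = b
            ; coef        = λ x → proj₁ (x≈lin x)
            ; spans       = λ x → ≡.subst (λ y → IsTorsion Γ (x ∙ y ⁻¹))
                                          (quotient-lin Γ torsionSub (proj₁ (x≈lin x)) b)
                                          (proj₂ (x≈lin x))
            ; independent = λ c c-torsion → b-indep c (T.respects (sym x∙ε⁻¹≈x)
                (≡.subst (IsTorsion Γ) (≡.sym (quotient-lin Γ torsionSub c b)) c-torsion))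
            }

  module _ (B : BasisModTorsion Γ) where
    open BasisModTorsion B

    multiple∈span : ∀ x → ∃ λ N → N ≢ 0ℤ × ∃ λ c → N · x ≈ lin c vec
    multiple∈span x =
      let N , N≢0 , Nx≈ε = torsion⇒·≈ε (spans x)
      in  N , N≢0 , (λ i → N ℤ.* coef x i) , x∙y⁻¹≈ε⇒x≈y _ _ (begin
        N · x ∙ lin (λ i → N ℤ.* coef x i) vec ⁻¹  ≈⟨ ∙-congˡ (⁻¹-cong (lin-· N (coef x) vec)) ⟩
        N · x ∙ (N · lin (coef x) vec) ⁻¹          ≈⟨ ∙-congˡ (·-⁻¹ N _) ⟨
        N · x ∙ N · (lin (coef x) vec ⁻¹)          ≈⟨ ·-distribˡ N _ _ ⟨
        N · (x ∙ lin (coef x) vec ⁻¹)              ≈⟨ Nx≈ε ⟩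
        ε                                          ∎)

    basis⇒hasRank : HasRank Γ size
    basis⇒hasRank =
      (vec , λ c rel → independent c (≈ε⇒torsion rel)) ,
      λ k v v-indep → lin-size-≤ v vec v-indep (λ i → multiple∈span (v i))

-- Building homomorphisms; additivity of the rank along a quotient

module _ {a b ℓ ℓ′ : Level} (Γ : AbelianGroup a ℓ) (Δ : AbelianGroup b ℓ′) where
  private
    module Γ = AbelianGroup Γ
  open AbelianGroup Δ
  open AbelianGroupProperties Δ

  mkHom : (f : Γ.Carrier → Carrier) → (∀ {x y} → x Γ.≈ y → f x ≈ f y) →
          (∀ x y → f (x Γ.∙ y) ≈ f x ∙ f y) → GroupHomomorphism Γ.rawGroup rawGroup
  mkHom f f-cong f-∙ = record
    { ⟦_⟧ = f
    ; isGroupHomomorphism = record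
      { isMonoidHomomorphism = record
        { isMagmaHomomorphism = record
          { isRelHomomorphism = record { cong = f-cong }
          ; homo = f-∙
          }
        ; ε-homo = f-ε
        }
      ; ⁻¹-homo = λ x → inverseˡ-unique _ _
          (trans (sym (f-∙ (x Γ.⁻¹) x)) (trans (f-cong (Γ.inverseˡ x)) f-ε))
      }
    }
    where
    f-ε : f Γ.ε ≈ ε
    f-ε = begin
      f Γ.ε                           ≈⟨ identityʳ _ ⟨
      f Γ.ε ∙ ε                       ≈⟨ ∙-congˡ (inverseʳ _) ⟨
      f Γ.ε ∙ (f Γ.ε ∙ f Γ.ε ⁻¹)      ≈⟨ assoc _ _ _ ⟨
      (f Γ.ε ∙ f Γ.ε) ∙ f Γ.ε ⁻¹      ≈⟨ ∙-congʳ (f-∙ Γ.ε Γ.ε) ⟨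
      f (Γ.ε Γ.∙ Γ.ε) ∙ f Γ.ε ⁻¹      ≈⟨ ∙-congʳ (f-cong (Γ.identityʳ Γ.ε)) ⟩
      f Γ.ε ∙ f Γ.ε ⁻¹                ≈⟨ inverseʳ _ ⟩
      ε                               ∎
      where open ≈-Reasoning setoid

module _ {a ℓ p : Level} (Γ : AbelianGroup a ℓ) {P : AbelianGroup.Carrier Γ → Set p}
         (H : IsSubgroup Γ P) where
  open AbelianGroup Γ
  open AbelianGroupProperties Γ
  open IntegerMultiples Γ
  open Generation Γ using (lin-size-≤)
  open ≈-Reasoning setoid
  private
    Q = quotient Γ H
    S = subgroup Γ H
    module H = IsSubgroup H

  inclusion : GroupHomomorphism (AbelianGroup.rawGroup S) rawGroup
  inclusion = mkHom S Γ proj₁ (λ x≈y → x≈y) (λ _ _ → refl)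

  -- The vectors of `C` are representatives in `Γ` and are placed after those of `B`. A relation
  -- read modulo the subgroup kills the `C` coefficients, and what is left is a relation inside the
  -- subgroup. For maximality, some multiple of `x` agrees with a combination of `C.vec` up to an
  -- element of the subgroup, and a further multiple of that element lies in the span of `B`.
  hasRank-+ : (B : BasisModTorsion S) (C : BasisModTorsion Q) → HasRank Γ (BasisModTorsion.size B ℕ.+ BasisModTorsion.size C)
  hasRank-+ B C = (w , w-indep) , λ k v v-indep → lin-size-≤ v w v-indep (λ i → multiple (v i))
    where
    module B = BasisModTorsion B
    module C = BasisModTorsion C
    u = λ i → proj₁ (B.vec i)
    w = u ++ C.vec

    lin-split : ∀ c → lin c w ≈ lin (λ i → c (i ↑ˡ C.size)) u ∙ lin (λ i → c (B.size ↑ʳ i)) C.vec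
    lin-split c = trans (sum-split B.size (λ i → c i · w i)) (∙-cong
      (lin-cong {c = λ i → c (i ↑ˡ C.size)} (λ _ → ≡.refl) (λ i → reflexive (lookup-++ˡ u C.vec i)))
      (lin-cong {c = λ i → c (B.size ↑ʳ i)} (λ _ → ≡.refl) (λ i → reflexive (lookup-++ʳ u C.vec i))))

    module _ (c : Vector ℤ (B.size ℕ.+ C.size)) (rel : lin c w ≈ ε) where
      c₁ : Vector ℤ B.size
      c₁ i = c (i ↑ˡ C.size)
      c₂ : Vector ℤ C.size
      c₂ i = c (B.size ↑ʳ i)

      split : lin c₁ u ∙ lin c₂ C.vec ≈ ε
      split = trans (sym (lin-split c)) rel

      c₂≡0 : ∀ j → c₂ j ≡ 0ℤ
      -- By the relation, the `C` part is the inverse of the `B` part, hence lies in the subgroup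
      -- and is trivial in the quotient.
      c₂≡0 = C.independent c₂ (Generation.≈ε⇒torsion Q (≡.subst (λ y → P (y ∙ ε ⁻¹))
        (≡.sym (quotient-lin Γ H c₂ C.vec))
        (H.respects (sym (trans (x∙ε⁻¹≈x Γ) (inverseʳ-unique _ _ split)))
          (H.⁻¹-closed (lin∈subgroup H c₁ u (λ i → proj₂ (B.vec i)))))))

      c₁≡0 : ∀ j → c₁ j ≡ 0ℤ
      c₁≡0 = B.independent c₁ (Generation.≈ε⇒torsion S (begin
        proj₁ (IntegerMultiples.lin S c₁ B.vec)  ≈⟨ lin-homo S Γ inclusion c₁ B.vec ⟩
        lin c₁ u                                 ≈⟨ identityʳ _ ⟨
        lin c₁ u ∙ ε                             ≈⟨ ∙-congˡ (lin-0 c₂ C.vec c₂≡0) ⟨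
        lin c₁ u ∙ lin c₂ C.vec                  ≈⟨ split ⟩
        ε                                        ∎))

      w-indep : ∀ i → c i ≡ 0ℤ
      w-indep i with splitAt B.size i in eq
      ... | inj₁ j = ≡.trans (≡.cong c (≡.sym (splitAt⁻¹-↑ˡ eq))) (c₁≡0 j)
      ... | inj₂ j = ≡.trans (≡.cong c (≡.sym (splitAt⁻¹-↑ʳ eq))) (c₂≡0 j)

    multiple : ∀ x → ∃ λ N → N ≢ 0ℤ × ∃ λ c → N · x ≈ lin c w
    multiple x =
      let N , N≢0 , c , Nx∼ = multiple∈span Q C x
          Nx-l∈P : P (N · x ∙ lin c C.vec ⁻¹)
          Nx-l∈P = ≡.subst₂ (λ y z → P (y ∙ z ⁻¹)) (quotient-· Γ H N x) (quotient-lin Γ H c C.vec) Nx∼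
          M , M≢0 , d , Mz≈ = multiple∈span S B (N · x ∙ lin c C.vec ⁻¹ , Nx-l∈P)
          e : Vector ℤ (B.size ℕ.+ C.size)
          e = d ++ (λ i → M ℤ.* c i)
      in  M ℤ.* N , *-≢0 M≢0 N≢0 , e , (begin
            (M ℤ.* N) · x
              ≈⟨ ·-assoc M N x ⟩
            M · N · x
              ≈⟨ ·-congˡ M (//-rightDividesˡ (lin c C.vec) (N · x)) ⟨
            M · ((N · x ∙ lin c C.vec ⁻¹) ∙ lin c C.vec)
              ≈⟨ ·-distribˡ M _ _ ⟩
            M · (N · x ∙ lin c C.vec ⁻¹) ∙ M · lin c C.vec
              ≈⟨ ∙-cong (sym (·-homo S Γ inclusion M _)) (sym (lin-· M c C.vec)) ⟩
            proj₁ (IntegerMultiples._·_ S M (N · x ∙ lin c C.vec ⁻¹ , Nx-l∈P)) ∙ lin (λ i → M ℤ.* c i) C.vec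
              ≈⟨ ∙-congʳ (trans Mz≈ (lin-homo S Γ inclusion d B.vec)) ⟩
            lin d u ∙ lin (λ i → M ℤ.* c i) C.vec
              ≈⟨ ∙-cong (lin-cong (λ i → lookup-++ˡ d (λ i → M ℤ.* c i) i) (λ _ → refl))
                        (lin-cong (λ i → lookup-++ʳ d (λ i → M ℤ.* c i) i) (λ _ → refl)) ⟨
            lin (λ i → e (i ↑ˡ C.size)) u ∙ lin (λ i → e (B.size ↑ʳ i)) C.vec
              ≈⟨ lin-split e ⟨
            lin e w ∎)

-- Cardinalities of setoids and Boolean counting

private
  variable
    a b ℓ ℓ′ : Level
    k n h : ℕ

FinS : ℕ → Setoid _ _
FinS n = ≡.setoid (Fin n)

mkInverse : {X : Setoid a ℓ} {Y : Setoid b ℓ′} →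
            let module X = Setoid X ; module Y = Setoid Y in
            (to : X.Carrier → Y.Carrier) (from : Y.Carrier → X.Carrier) →
            (∀ {x x′} → x X.≈ x′ → to x Y.≈ to x′) → (∀ {y y′} → y Y.≈ y′ → from y X.≈ from y′) →
            (∀ y → to (from y) Y.≈ y) → (∀ x → from (to x) X.≈ x) → Inverse X Y
mkInverse {X = X} {Y = Y} to from to-cong from-cong to-from from-to = record
  { to        = to
  ; from      = from
  ; to-cong   = to-cong
  ; from-cong = from-cong
  ; inverse   = (λ y≈ → Y.trans (to-cong y≈) (to-from _)) , (λ x≈ → X.trans (from-cong x≈) (from-to _))
  }
  where
  module X = Setoid X
  module Y = Setoid Y

¬¬-∀ : {P : Fin n → Set a} → (∀ i → ¬ ¬ P i) → ¬ ¬ (∀ i → P i)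
¬¬-∀ = sequence (RawMonad.rawApplicative ¬¬-Monad)

hasCardinality-unique : {X : Setoid a ℓ} → HasCardinality X k → HasCardinality X n → k ≡ n
hasCardinality-unique X↔k X↔n = cantor-schröder-bernstein
  (Injection.injective (Inverse⇒Injection (Composition.inverse X↔k (Symmetry.inverse X↔n))))
  (Injection.injective (Inverse⇒Injection (Composition.inverse X↔n (Symmetry.inverse X↔k))))

hasCardinality-× : {X : Setoid a ℓ} {Y : Setoid b ℓ′} →
                   HasCardinality X k → HasCardinality Y n → HasCardinality (X ×ₛ Y) (k ℕ.* n)
hasCardinality-× X↔k Y↔n = Composition.inverse *↔×
  (Composition.inverse (Symmetry.inverse Pointwise-≡↔≡) (X↔k ×-inverse Y↔n))

funToFin-cong : ∀ {f g : Fin k → Fin n} → (∀ i → f i ≡ g i) → funToFin f ≡ funToFin g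
funToFin-cong {k = zero}  f≗g = ≡.refl
funToFin-cong {k = suc k} f≗g = ≡.cong₂ combine (f≗g zero) (funToFin-cong (f≗g ∘ suc))

hasCardinality-^ : {X : Setoid a ℓ} → HasCardinality X n →
                   ∀ m → HasCardinality (VecEquality.≋-setoid X m) (n ℕ.^ m)
hasCardinality-^ {n = n} {X = X} X↔n m = mkInverse
  (λ i j → to (finToFun i j))
  (λ v → funToFin (from ∘ v))
  (λ { ≡.refl _ → X.refl })
  (λ v≈w → funToFin-cong (λ j → from-cong (v≈w j)))
  (λ v j → X.trans (to-cong (finToFun-funToFin (from ∘ v) j)) (strictlyInverseˡ (v j)))
  (λ i → ≡.trans (funToFin-cong {k = m} (λ j → strictlyInverseʳ (finToFun {n} {m} i j)))
                 (funToFin-finToFin {m} {n} i))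
  where
  module X = Setoid X
  open Inverse X↔n

does-sound : {A : Set a} (d : Dec A) → does d ≡ true → A
does-sound (yes x) _ = x

𝟙 : Bool → ℕ
𝟙 x = if x then 1 else 0

count : (Fin h → Bool) → ℕ
count {zero}  D = 0
count {suc h} D = 𝟙 (D zero) ℕ.+ count (D ∘ suc)

enumerate : (D : Fin h → Bool) → ∃ λ (e : Fin (count D) → Fin h) →
            Injective _≡_ _≡_ e × (∀ j → D (e j) ≡ true) × (∀ i → D i ≡ true → ∃ λ j → e j ≡ i)
enumerate {zero}  D = (λ ()) , (λ {}) , (λ ()) , λ ()
enumerate {suc h} D with enumerate (D ∘ suc) | D zero in eq
... | e , e-inj , e-sound , e-complete | true =
  (λ { zero → zero ; (suc j) → suc (e j) }) ,
  (λ { {zero} {zero} _ → ≡.refl ; {suc i} {suc j} eq → ≡.cong suc (e-inj (suc-injective eq)) }) ,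
  (λ { zero → eq ; (suc j) → e-sound j }) ,
  (λ { zero _ → zero , ≡.refl
     ; (suc i) Di → let j , ej≡i = e-complete i Di in suc j , ≡.cong suc ej≡i })
... | e , e-inj , e-sound , e-complete | false =
  (λ j → suc (e j)) ,
  (λ eq → e-inj (suc-injective eq)) ,
  e-sound ,
  (λ { zero    D₀ → contradiction (≡.trans (≡.sym D₀) eq) λ ()
     ; (suc i) Di → let j , ej≡i = e-complete i Di in j , ≡.cong suc ej≡i })

module _ {Y : Setoid a ℓ} (ι : Injection Y (FinS h)) where
  open Injection ι
  private
    module Y = Setoid Y

  -- `D` decides the image of `ι`, so its true positions enumerate `Y`; injectivity makes the chosen
  -- preimages independent of choice up to the equality of `Y`.
  hasCardinality-image : (D : Fin h → Bool) → (∀ y → D (to y) ≡ true) →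
                         (∀ i → D i ≡ true → ∃ λ y → to y ≡ i) → HasCardinality Y (count D)
  hasCardinality-image D D-sound D-complete = mkInverse
    (λ j → proj₁ (preimage j))
    (λ y → proj₁ (index y))
    (λ { ≡.refl → Y.refl })
    (λ {x} {y} x≈y → e-inj (≡.trans (proj₂ (index x)) (≡.trans (cong x≈y) (≡.sym (proj₂ (index y))))))
    (λ y → injective (≡.trans (proj₂ (preimage (proj₁ (index y)))) (proj₂ (index y))))
    (λ j → e-inj (≡.trans (proj₂ (index _)) (proj₂ (preimage j))))
    where
    enum  = enumerate D
    e     = proj₁ enum
    e-inj = proj₁ (proj₂ enum)
    preimage : ∀ j → ∃ λ y → to y ≡ e j
    preimage j = D-complete (e j) (proj₁ (proj₂ (proj₂ enum)) j)
    index : ∀ y → ∃ λ j → e j ≡ to y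
    index y = proj₂ (proj₂ (proj₂ enum)) (to y) (D-sound y)

  -- Membership in the image need not be decidable, but it is so up to double negation at each
  -- point, and double negation commutes with the finite conjunction over `Fin h`.
  ¬¬-finite : ¬ ¬ (∃ λ k → HasCardinality Y k)
  ¬¬-finite = ¬¬-map
    (λ im? → let D = λ i → does (im? i) in
       count D , hasCardinality-image D (λ y → dec-true (im? (to y)) (y , ≡.refl))
                                        (λ i → does-sound (im? i)))
    (¬¬-∀ λ i → ¬¬-excluded-middle)

module _ {X : Setoid a ℓ} {Y : Setoid b ℓ′} (ι : Injection X Y) where
  finite⇒injection : HasCardinality Y h → Injection X (FinS h)
  finite⇒injection Y↔h = Composition.injection ι (Inverse⇒Injection (Symmetry.inverse Y↔h))

-- Homomorphisms on torsion, on a basis and on a quotient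

module _ (Γ : AbelianGroup a ℓ) (G : AbelianGroup b ℓ′) where
  private
    module Γ = AbelianGroup Γ
    module Γₚ = AbelianGroupProperties Γ
    module Γᵐ = IntegerMultiples Γ
  open AbelianGroup G
  open AbelianGroupProperties G
  open IntegerMultiples G
  open CommutativeSemigroupProperties commutativeSemigroup using (interchange)
  open GroupHomomorphism using (⟦_⟧; ⟦⟧-cong; homo; ε-homo; ⁻¹-homo)

  agree-generated : ∀ {p} {P : Γ.Carrier → Set p} (φ ψ : Setoid.Carrier (Hom Γ G)) →
                    (∀ {x} → P x → ⟦ φ ⟧ x ≈ ⟦ ψ ⟧ x) → ∀ {x} → Generated Γ P x → ⟦ φ ⟧ x ≈ ⟦ ψ ⟧ x
  agree-generated φ ψ eq (gen Px)     = eq Px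
  agree-generated φ ψ eq (resp x≈y g) =
    trans (sym (⟦⟧-cong φ x≈y)) (trans (agree-generated φ ψ eq g) (⟦⟧-cong ψ x≈y))
  agree-generated φ ψ eq unit         = trans (ε-homo φ) (sym (ε-homo ψ))
  agree-generated φ ψ eq (mul g h)    = trans (homo φ _ _)
    (trans (∙-cong (agree-generated φ ψ eq g) (agree-generated φ ψ eq h)) (sym (homo ψ _ _)))
  agree-generated φ ψ eq (inv g)      =
    trans (⁻¹-homo φ _) (trans (⁻¹-cong (agree-generated φ ψ eq g)) (sym (⁻¹-homo ψ _)))

  evaluate-generators : ((k , _) : FinitelyGenerated Γ) →
                        Injection (Hom Γ G) (VecEquality.≋-setoid setoid k)
  evaluate-generators (k , g , g-gen) = record
    { to        = λ φ i → ⟦ φ ⟧ (g i)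
    ; cong      = λ φ≈ψ i → φ≈ψ (g i)
    ; injective = λ {φ} {ψ} eq x → agree-generated φ ψ
        (λ (i , x≈gi) → trans (⟦⟧-cong φ x≈gi) (trans (eq i) (sym (⟦⟧-cong ψ x≈gi)))) (g-gen x)
    }

  Hom-¬¬finite : ∀ {q} → HasCardinality setoid q → FinitelyGenerated Γ →
                 ¬ ¬ (∃ λ h → HasCardinality (Hom Γ G) h)
  Hom-¬¬finite G↔q fg =
    ¬¬-finite (finite⇒injection (evaluate-generators fg) (hasCardinality-^ G↔q (proj₁ fg)))

  module _ (B : BasisModTorsion Γ) where
    open BasisModTorsion B
    private
      T = torsionSubgroup Γ
      module T = IsSubgroup (torsion-isSubgroup Γ)

      torsionPart : Γ.Carrier → Σ Γ.Carrier (IsTorsion Γ)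
      torsionPart x = x Γ.∙ Γᵐ.lin (coef x) vec Γ.⁻¹ , spans x

    -- Subtracting the two torsion remainders of `x` cancels `x` and leaves a torsion combination
    -- with coefficients `coef x i ℤ.- c i`, to which `independent` applies.
    coef-unique : ∀ x c → IsTorsion Γ (x Γ.∙ Γᵐ.lin c vec Γ.⁻¹) → ∀ i → coef x i ≡ c i
    coef-unique x c c-spans i = ℤₚ.i-j≡0⇒i≡j (coef x i) (c i)
      (independent (λ i → coef x i ℤ.- c i) (T.respects eq (T.∙-closed c-spans (T.⁻¹-closed (spans x)))) i)
      where
      l = Γᵐ.lin (coef x) vec
      l′ = Γᵐ.lin c vec
      eq : (x Γ.∙ l′ Γ.⁻¹) Γ.∙ (x Γ.∙ l Γ.⁻¹) Γ.⁻¹ Γ.≈ Γᵐ.lin (λ i → coef x i ℤ.- c i) vec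
      eq = begin
        (x Γ.∙ l′ Γ.⁻¹) Γ.∙ (x Γ.∙ l Γ.⁻¹) Γ.⁻¹   ≈⟨ Γᵐ.cancelCommon x (l′ Γ.⁻¹) (l Γ.⁻¹) ⟩
        l′ Γ.⁻¹ Γ.∙ l Γ.⁻¹ Γ.⁻¹                   ≈⟨ Γ.∙-congˡ (Γₚ.⁻¹-involutive l) ⟩
        l′ Γ.⁻¹ Γ.∙ l                             ≈⟨ Γ.comm _ _ ⟩
        l Γ.∙ l′ Γ.⁻¹                             ≈⟨ Γ.∙-congˡ (Γᵐ.lin-neg c vec) ⟨
        l Γ.∙ Γᵐ.lin (λ i → ℤ.- c i) vec          ≈⟨ Γᵐ.lin-+ (coef x) (λ i → ℤ.- c i) vec ⟨
        Γᵐ.lin (λ i → coef x i ℤ.- c i) vec       ∎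
        where open ≈-Reasoning Γ.setoid

    coef-cong : ∀ {x y} → x Γ.≈ y → ∀ i → coef x i ≡ coef y i
    coef-cong {x} {y} x≈y = coef-unique x (coef y) (T.respects (Γ.∙-congʳ (Γ.sym x≈y)) (spans y))

    private
      lin-split : ∀ x y → (x Γ.∙ Γᵐ.lin (coef x) vec Γ.⁻¹) Γ.∙ (y Γ.∙ Γᵐ.lin (coef y) vec Γ.⁻¹) Γ.≈
                  (x Γ.∙ y) Γ.∙ Γᵐ.lin (λ i → coef x i ℤ.+ coef y i) vec Γ.⁻¹
      lin-split x y = begin
        (x Γ.∙ l Γ.⁻¹) Γ.∙ (y Γ.∙ l′ Γ.⁻¹)  ≈⟨ C.interchange x (l Γ.⁻¹) y (l′ Γ.⁻¹) ⟩
        (x Γ.∙ y) Γ.∙ (l Γ.⁻¹ Γ.∙ l′ Γ.⁻¹)  ≈⟨ Γ.∙-congˡ (Γₚ.⁻¹-∙-comm l l′) ⟩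
        (x Γ.∙ y) Γ.∙ (l Γ.∙ l′) Γ.⁻¹       ≈⟨ Γ.∙-congˡ (Γ.⁻¹-cong (Γᵐ.lin-+ (coef x) (coef y) vec)) ⟨
        (x Γ.∙ y) Γ.∙ Γᵐ.lin (λ i → coef x i ℤ.+ coef y i) vec Γ.⁻¹ ∎
        where
        module C = CommutativeSemigroupProperties Γ.commutativeSemigroup
        l = Γᵐ.lin (coef x) vec
        l′ = Γᵐ.lin (coef y) vec
        open ≈-Reasoning Γ.setoid

    coef-∙ : ∀ x y i → coef (x Γ.∙ y) i ≡ coef x i ℤ.+ coef y i
    coef-∙ x y = coef-unique (x Γ.∙ y) _ (T.respects (lin-split x y) (T.∙-closed (spans x) (spans y)))

    coef-torsion : ∀ {x} → IsTorsion Γ x → ∀ i → coef x i ≡ 0ℤ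
    coef-torsion {x} x-torsion = coef-unique x (λ _ → 0ℤ) (T.respects (Γ.sym (begin
      x Γ.∙ Γᵐ.lin (λ _ → 0ℤ) vec Γ.⁻¹  ≈⟨ Γ.∙-congˡ (Γ.⁻¹-cong (Γᵐ.lin-0 _ vec λ _ → ≡.refl)) ⟩
      x Γ.∙ Γ.ε Γ.⁻¹                    ≈⟨ x∙ε⁻¹≈x Γ ⟩
      x                                 ∎)) x-torsion)
      where open ≈-Reasoning Γ.setoid

    coef-vec : ∀ i j → coef (vec i) j ≡ Generation.unitVector Γ i j
    coef-vec i = coef-unique (vec i) _ (Generation.≈ε⇒torsion Γ
      (Γₚ.x≈y⇒x∙y⁻¹≈ε (Γ.sym (Generation.lin-unitVector Γ i vec))))

    private
      restrict : Setoid.Carrier (Hom Γ G) → Setoid.Carrier (Hom T G)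
      restrict φ = mkHom T G (λ t → ⟦ φ ⟧ (proj₁ t)) (⟦⟧-cong φ) (λ s t → homo φ (proj₁ s) (proj₁ t))

      extend : Setoid.Carrier (Hom T G) → Vector Carrier size → Setoid.Carrier (Hom Γ G)
      extend ψ v = mkHom Γ G (λ x → ⟦ ψ ⟧ (torsionPart x) ∙ lin (coef x) v)
        (λ x≈y → ∙-cong
          (⟦⟧-cong ψ (Γ.∙-cong x≈y (Γ.⁻¹-cong (Γᵐ.lin-cong (coef-cong x≈y) (λ _ → Γ.refl)))))
          (lin-cong (coef-cong x≈y) (λ _ → refl)))
        (λ x y → begin
          ⟦ ψ ⟧ (torsionPart (x Γ.∙ y)) ∙ lin (coef (x Γ.∙ y)) v
            ≈⟨ ∙-cong
                 (⟦⟧-cong ψ (Γ.trans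
                   (Γ.∙-congˡ (Γ.⁻¹-cong (Γᵐ.lin-cong (coef-∙ x y) (λ _ → Γ.refl))))
                   (Γ.sym (lin-split x y))))
                 (trans (lin-cong (coef-∙ x y) (λ _ → refl)) (lin-+ (coef x) (coef y) v)) ⟩
          ⟦ ψ ⟧ (AbelianGroup._∙_ T (torsionPart x) (torsionPart y)) ∙ (lin (coef x) v ∙ lin (coef y) v)
            ≈⟨ ∙-congʳ (homo ψ (torsionPart x) (torsionPart y)) ⟩
          (⟦ ψ ⟧ (torsionPart x) ∙ ⟦ ψ ⟧ (torsionPart y)) ∙ (lin (coef x) v ∙ lin (coef y) v)
            ≈⟨ interchange _ _ _ _ ⟩
          (⟦ ψ ⟧ (torsionPart x) ∙ lin (coef x) v) ∙ (⟦ ψ ⟧ (torsionPart y) ∙ lin (coef y) v) ∎)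
        where open ≈-Reasoning setoid

    -- Each `x` is its torsion part times a combination of the basis with unique coordinates. A
    -- homomorphism is thus a homomorphism on torsion together with freely chosen values on the
    -- basis.
    Hom↔Hom-torsion×vec : Inverse (Hom Γ G) (Hom T G ×ₛ VecEquality.≋-setoid setoid size)
    Hom↔Hom-torsion×vec = mkInverse
      (λ φ → restrict φ , λ i → ⟦ φ ⟧ (vec i))
      (λ (ψ , v) → extend ψ v)
      (λ φ≈ψ → (λ t → φ≈ψ (proj₁ t)) , (λ i → φ≈ψ (vec i)))
      (λ (ψ≈ψ′ , v≈v′) x →
        ∙-cong (ψ≈ψ′ (torsionPart x)) (lin-cong {c = coef x} (λ _ → ≡.refl) v≈v′))
      (λ (ψ , v) →
        (λ (t , t-torsion) → trans
          (∙-cong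
            (⟦⟧-cong ψ (Γ.trans
              (Γ.∙-congˡ (Γ.⁻¹-cong (Γᵐ.lin-0 _ vec (coef-torsion t-torsion)))) (x∙ε⁻¹≈x Γ)))
            (lin-0 _ v (coef-torsion t-torsion)))
          (identityʳ _)) ,
        (λ i → trans
          (∙-cong
            (trans (⟦⟧-cong ψ {y = AbelianGroup.ε T} (Γₚ.x≈y⇒x∙y⁻¹≈ε (Γ.sym (Γ.trans
                     (Γᵐ.lin-cong (coef-vec i) (λ _ → Γ.refl))
                     (Generation.lin-unitVector Γ i vec)))))
                   (ε-homo ψ))
            (trans (lin-cong (coef-vec i) (λ _ → refl)) (Generation.lin-unitVector G i v)))
          (identityˡ _)))
      (λ φ x → trans
        (∙-congˡ (sym (lin-homo Γ G φ (coef x) vec)))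
        (trans (sym (homo φ _ _)) (⟦⟧-cong φ (Γₚ.//-rightDividesˡ _ x))))

    -- Sending the basis to `ε` embeds homomorphisms on torsion into `Hom Γ G`, so their finiteness
    -- is inherited and no generators of the torsion subgroup have to be found.
    Hom-torsion-injection : Injection (Hom T G) (Hom Γ G)
    Hom-torsion-injection = record
      { to        = λ ψ → extend ψ (λ _ → ε)
      ; cong      = λ ψ≈ψ′ x → ∙-congʳ (ψ≈ψ′ (torsionPart x))
      ; injective = λ {ψ} {ψ′} eq → proj₁ (Injection.injective
          (Inverse⇒Injection (Symmetry.inverse Hom↔Hom-torsion×vec))
          {x = ψ , λ _ → ε} {y = ψ′ , λ _ → ε} eq)
      }

  module _ {p} {P : Γ.Carrier → Set p} (H : IsSubgroup Γ P) where
    private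
      Q = quotient Γ H
      module H = IsSubgroup H

    Hom-quotient-injection : Injection (Hom Q G) (Hom Γ G)
    Hom-quotient-injection = record
      { to        = λ φ → mkHom Γ G ⟦ φ ⟧
          (λ x≈y → ⟦⟧-cong φ (H.respects (Γ.sym (Γₚ.x≈y⇒x∙y⁻¹≈ε x≈y)) H.ε-closed)) (homo φ)
      ; cong      = λ φ≈ψ → φ≈ψ
      ; injective = λ φ≈ψ → φ≈ψ
      }

    Hom-quotient-lift : (φ : Setoid.Carrier (Hom Γ G)) → (∀ {x} → P x → ⟦ φ ⟧ x ≈ ε) →
                        Setoid.Carrier (Hom Q G)
    Hom-quotient-lift φ φP≈ε = mkHom Q G ⟦ φ ⟧
      (λ {x} {y} xy⁻¹∈P → x∙y⁻¹≈ε⇒x≈y _ _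
        (trans (∙-congˡ (sym (⁻¹-homo φ y))) (trans (sym (homo φ _ _)) (φP≈ε xy⁻¹∈P))))
      (homo φ)

  -- Vanishing on a generated subgroup is agreement with this homomorphism, which lets
  -- `agree-generated` check it on generators.
  trivialHom : Setoid.Carrier (Hom Γ G)
  trivialHom = mkHom Γ G (λ _ → ε) (λ _ → refl) (λ _ _ → sym (identityʳ ε))

-- Inclusion-exclusion for Boolean tables

∑⊆-cong : {f g : Subset n → ℤ} → (∀ S → f S ≡ g S) → ∑⊆ f ≡ ∑⊆ g
∑⊆-cong {zero}  f≗g = f≗g []
∑⊆-cong {suc n} f≗g =
  ≡.cong₂ ℤ._+_ (∑⊆-cong (f≗g ∘ (outside ∷_))) (∑⊆-cong (f≗g ∘ (inside ∷_)))

∑⊆-0 : (f : Subset n → ℤ) → (∀ S → f S ≡ 0ℤ) → ∑⊆ f ≡ 0ℤ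
∑⊆-0 {zero}  f f≡0 = f≡0 []
∑⊆-0 {suc n} f f≡0 =
  ≡.cong₂ ℤ._+_ (∑⊆-0 (f ∘ (outside ∷_)) (f≡0 ∘ (outside ∷_))) (∑⊆-0 (f ∘ (inside ∷_)) (f≡0 ∘ (inside ∷_)))

∑⊆-+ : (f g : Subset n → ℤ) → ∑⊆ (λ S → f S ℤ.+ g S) ≡ ∑⊆ f ℤ.+ ∑⊆ g
∑⊆-+ {zero}  f g = ≡.refl
∑⊆-+ {suc n} f g = ≡.trans
  (≡.cong₂ ℤ._+_ (∑⊆-+ (f ∘ (outside ∷_)) (g ∘ (outside ∷_))) (∑⊆-+ (f ∘ (inside ∷_)) (g ∘ (inside ∷_))))
  (interchange (∑⊆ (f ∘ (outside ∷_))) _ _ _)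
  where open CommutativeSemigroupProperties ℤₚ.+-commutativeSemigroup using (interchange)

holdsOn : Subset n → (Fin n → Bool) → Bool
holdsOn []            p = true
holdsOn (outside ∷ S) p = holdsOn S (p ∘ suc)
holdsOn (inside  ∷ S) p = p zero ∧ holdsOn S (p ∘ suc)

holdsOn⁺ : (S : Subset n) (p : Fin n → Bool) → (∀ {i} → i ∈ S → p i ≡ true) → holdsOn S p ≡ true
holdsOn⁺ []            p all = ≡.refl
holdsOn⁺ (outside ∷ S) p all = holdsOn⁺ S (p ∘ suc) (all ∘ there)
holdsOn⁺ (inside  ∷ S) p all rewrite all here = holdsOn⁺ S (p ∘ suc) (all ∘ there)

holdsOn⁻ : (S : Subset n) (p : Fin n → Bool) → holdsOn S p ≡ true → ∀ {i} → i ∈ S → p i ≡ true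
holdsOn⁻ (outside ∷ S) p hold (there i∈S) = holdsOn⁻ S (p ∘ suc) hold i∈S
holdsOn⁻ (inside  ∷ S) p hold i∈S with p zero in eq
holdsOn⁻ (inside  ∷ S) p hold here        | true = eq
holdsOn⁻ (inside  ∷ S) p hold (there i∈S) | true = holdsOn⁻ S (p ∘ suc) hold i∈S

holdsNowhere : (Fin n → Bool) → Bool
holdsNowhere {zero}  p = true
holdsNowhere {suc n} p = not (p zero) ∧ holdsNowhere (p ∘ suc)

holdsNowhere⁺ : (p : Fin n → Bool) → (∀ i → p i ≡ false) → holdsNowhere p ≡ true
holdsNowhere⁺ {zero}  p none = ≡.refl
holdsNowhere⁺ {suc n} p none rewrite none zero = holdsNowhere⁺ (p ∘ suc) (none ∘ suc)

holdsNowhere⁻ : (p : Fin n → Bool) → holdsNowhere p ≡ true → ∀ i → p i ≡ false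
holdsNowhere⁻ {suc n} p nowhere i with p zero in eq
holdsNowhere⁻ {suc n} p nowhere zero    | false = eq
holdsNowhere⁻ {suc n} p nowhere (suc i) | false = holdsNowhere⁻ (p ∘ suc) nowhere i

sign : Subset n → ℤ
sign S = -1ℤ ℤ.^ ∣ S ∣

-- This expands the product of the factors `1 - p i`. If `p zero` is false, the sets containing
-- `zero` contribute nothing; if it is true, each set without `zero` cancels against the same set
-- with `zero` added.
inclusion-exclusion₁ : (p : Fin n → Bool) →
                       ∑⊆ (λ S → sign S ℤ.* + 𝟙 (holdsOn S p)) ≡ + 𝟙 (holdsNowhere p)
inclusion-exclusion₁ {zero}  p = ≡.refl
inclusion-exclusion₁ {suc n} p with p zero
... | false = ≡.trans
  (≡.cong₂ ℤ._+_ (inclusion-exclusion₁ (p ∘ suc)) (∑⊆-0 {n} _ λ S → ℤₚ.*-zeroʳ (-1ℤ ℤ.* sign S)))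
  (ℤₚ.+-identityʳ _)
... | true  = ≡.trans
  (≡.sym (∑⊆-+ {n} (λ S → sign S ℤ.* + 𝟙 (holdsOn S (p ∘ suc))) _))
  (∑⊆-0 {n} _ λ S → cancel (sign S) (+ 𝟙 (holdsOn S (p ∘ suc))))
  where
  cancel : ∀ x y → x ℤ.* y ℤ.+ (-1ℤ ℤ.* x) ℤ.* y ≡ 0ℤ
  cancel = solve-∀

inclusion-exclusion : (p : Fin h → Fin n → Bool) →
                      ∑⊆ (λ S → sign S ℤ.* + count (λ i → holdsOn S (p i))) ≡
                      + count (λ i → holdsNowhere (p i))
inclusion-exclusion {zero}  {n} p = ∑⊆-0 {n} _ λ S → ℤₚ.*-zeroʳ (sign S)
inclusion-exclusion {suc h} {n} p = begin
  ∑⊆ (λ S → sign S ℤ.* + (𝟙 (holdsOn S (p zero)) ℕ.+ count (λ i → holdsOn S (p (suc i)))))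
    ≡⟨ ∑⊆-cong {n} (λ S → ℤₚ.*-distribˡ-+ (sign S) (+ 𝟙 (holdsOn S (p zero))) _) ⟩
  ∑⊆ (λ S → sign S ℤ.* + 𝟙 (holdsOn S (p zero)) ℤ.+ sign S ℤ.* + count (λ i → holdsOn S (p (suc i))))
    ≡⟨ ∑⊆-+ {n} (λ S → sign S ℤ.* + 𝟙 (holdsOn S (p zero))) _ ⟩
  ∑⊆ (λ S → sign S ℤ.* + 𝟙 (holdsOn S (p zero))) ℤ.+
    ∑⊆ (λ S → sign S ℤ.* + count (λ i → holdsOn S (p (suc i))))
    ≡⟨ ≡.cong₂ ℤ._+_ (inclusion-exclusion₁ (p zero)) (inclusion-exclusion (p ∘ suc)) ⟩
  + count (λ i → holdsNowhere (p i)) ∎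
  where open ≡.≡-Reasoning

¬¬-∀⊆ : {P : Subset n → Set a} → (∀ S → ¬ ¬ P S) → ¬ ¬ (∀ S → P S)
¬¬-∀⊆ {zero}  ¬¬P none = ¬¬P [] λ P[] → none λ { [] → P[] }
¬¬-∀⊆ {suc n} ¬¬P none =
  ¬¬-∀⊆ (¬¬P ∘ (outside ∷_)) λ out → ¬¬-∀⊆ (¬¬P ∘ (inside ∷_)) λ in′ →
    none λ { (outside ∷ S) → out S ; (inside ∷ S) → in′ S }

pos-^ : ∀ m k → (+ m) ℤ.^ k ≡ + (m ℕ.^ k)
pos-^ m zero    = ≡.refl
pos-^ m (suc k) = ≡.trans (≡.cong (+ m ℤ.*_) (pos-^ m k)) (≡.sym (ℤₚ.pos-* m (m ℕ.^ k)))

-- Counting the complement of the arrangement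

module _ (Γ : AbelianGroup a ℓ) (fg : FinitelyGenerated Γ)
         (G : AbelianGroup b ℓ′) {q : ℕ} (G↔q : HasCardinality (AbelianGroup.setoid G) q)
         {n : ℕ} (𝒜 : Vector (AbelianGroup.Carrier Γ) n) where
  private
    module Γ = AbelianGroup Γ
    module G = AbelianGroup G
  open Arrangement Γ G 𝒜
  open GroupHomomorphism using (⟦_⟧)

  ⟨⟩-finitelyGenerated : ∀ S → FinitelyGenerated ⟨ S ⟩
  ⟨⟩-finitelyGenerated S = n , g , λ (x , x∈) → go x∈
    where
    g : Vector (AbelianGroup.Carrier ⟨ S ⟩) n
    g i with i ∈? S
    ... | yes i∈S = 𝒜 i , gen (i , i∈S , Γ.refl)
    -- Positions outside `S` carry the unit, so the family has length `n` for every `S` and the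
    -- members of `S` need not be enumerated.
    ... | no  _   = Γ.ε , unit

    g≡𝒜 : ∀ {i} → i ∈ S → proj₁ (g i) ≡ 𝒜 i
    g≡𝒜 {i} i∈S with i ∈? S
    ... | yes _   = ≡.refl
    ... | no  i∉S = contradiction i∈S i∉S

    go : ∀ {x} (x∈ : Generated Γ (entries S) x) →
         Generated ⟨ S ⟩ (Generation.InRange ⟨ S ⟩ g) (x , x∈)
    go (gen (i , i∈S , x≈𝒜i)) = gen (i , Γ.trans x≈𝒜i (Γ.reflexive (≡.sym (g≡𝒜 i∈S))))
    go (resp x≈y x∈)          = resp x≈y (go x∈)
    go unit                   = unit
    go (mul x∈ y∈)            = mul (go x∈) (go y∈)
    go (inv x∈)               = inv (go x∈)

  ⟨⟩-isSubgroup : ∀ S → IsSubgroup Γ (Generated Γ (entries S))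
  ⟨⟩-isSubgroup S = generated-isSubgroup Γ (entries S)

  bases-exist : ¬ ¬ (∀ S → BasisModTorsion ⟨ S ⟩ × BasisModTorsion Γ/⟨ S ⟩)
  bases-exist = ¬¬-∀⊆ λ S none →
    basis-exists ⟨ S ⟩ (⟨⟩-finitelyGenerated S) λ B →
    basis-exists Γ/⟨ S ⟩ (quotient-finitelyGenerated Γ (⟨⟩-isSubgroup S) fg) λ C →
    none (B , C)

  ℳ-injection : Injection ℳ (Hom Γ G)
  ℳ-injection = record { to = proj₁ ; cong = λ φ≈ψ → φ≈ψ ; injective = λ φ≈ψ → φ≈ψ }

  module _ {h : ℕ} (Hom↔h : HasCardinality (Hom Γ G) h) where
    private
      module H = Inverse Hom↔h

      _≟_ : Decidable G._≈_
      _≟_ = inj⇒≟ (Inverse⇒Injection (Symmetry.inverse G↔q))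

    vanishes : Fin h → Fin n → Bool
    vanishes i j = does (⟦ H.to i ⟧ (𝒜 j) ≟ G.ε)

    vanishes⁺ : ∀ φ {j} → ⟦ φ ⟧ (𝒜 j) G.≈ G.ε → vanishes (H.from φ) j ≡ true
    vanishes⁺ φ {j} φ≈ε = dec-true (_ ≟ _) (G.trans (H.strictlyInverseˡ φ (𝒜 j)) φ≈ε)

    vanishes⁻ : ∀ i {j} → vanishes i j ≡ true → ⟦ H.to i ⟧ (𝒜 j) G.≈ G.ε
    vanishes⁻ i = does-sound (_ ≟ _)

    ℳ-hasCardinality : HasCardinality ℳ (count (λ i → holdsNowhere (vanishes i)))
    ℳ-hasCardinality = hasCardinality-image (finite⇒injection ℳ-injection Hom↔h) _
      (λ (φ , φ≉ε) → holdsNowhere⁺ (vanishes (H.from φ)) λ j →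
        dec-false (_ ≟ _) λ eq → φ≉ε (j , G.trans (G.sym (H.strictlyInverseˡ φ (𝒜 j))) eq))
      (λ i nowhere →
        (H.to i , λ (j , φ≈ε) → contradiction
          (≡.trans (≡.sym (dec-true (_ ≟ _) φ≈ε)) (holdsNowhere⁻ (vanishes i) nowhere j)) λ ()) ,
        H.strictlyInverseʳ i)

    -- A homomorphism descends to the quotient exactly when it kills the entries selected by `S`,
    -- since these generate `⟨ S ⟩`; that condition is read off the table `vanishes`.
    Hom-quotient-hasCardinality : ∀ S →
      HasCardinality (Hom Γ/⟨ S ⟩ G) (count (λ i → holdsOn S (vanishes i)))
    Hom-quotient-hasCardinality S =
      hasCardinality-image (finite⇒injection (Hom-quotient-injection Γ G (⟨⟩-isSubgroup S)) Hom↔h) _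
      (λ φ → holdsOn⁺ S _ λ {j} j∈S →
        vanishes⁺ (Injection.to (Hom-quotient-injection Γ G (⟨⟩-isSubgroup S)) φ)
          (G.trans (GroupHomomorphism.⟦⟧-cong φ
                     (IsSubgroup.respects (⟨⟩-isSubgroup S) (Γ.sym (x∙ε⁻¹≈x Γ))
                       (gen (j , j∈S , Γ.refl))))
                   (GroupHomomorphism.ε-homo φ)))
      (λ i hold →
        Hom-quotient-lift Γ G (⟨⟩-isSubgroup S) (H.to i)
          (agree-generated Γ G (H.to i) (trivialHom Γ G) λ (j , j∈S , x≈𝒜j) →
            G.trans (GroupHomomorphism.⟦⟧-cong (H.to i) x≈𝒜j)
                    (vanishes⁻ i (holdsOn⁻ S (vanishes i) hold j∈S))) ,
        ≡.trans (H.from-cong (λ _ → G.refl)) (H.strictlyInverseʳ i))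

    module _ (bases : ∀ S → BasisModTorsion ⟨ S ⟩ × BasisModTorsion Γ/⟨ S ⟩) (I : Invariants) where
      open Invariants I

      -- The rank of `Γ` is the sum of the two basis sizes, so the truncated subtraction in the
      -- exponent of `χ` loses nothing.
      corank : ∀ S → r-Γ ∸ r S ≡ BasisModTorsion.size (proj₂ (bases S))
      corank S = begin
        r-Γ ∸ r S                        ≡⟨ ≡.cong₂ _∸_
          (Generation.hasRank-unique Γ r-Γ-rank (hasRank-+ Γ (⟨⟩-isSubgroup S) B C))
          (Generation.hasRank-unique ⟨ S ⟩ (r-rank S) (basis⇒hasRank ⟨ S ⟩ B)) ⟩
        BasisModTorsion.size B ℕ.+ BasisModTorsion.size C ∸ BasisModTorsion.size B ≡⟨ ℕₚ.m+n∸m≡n (BasisModTorsion.size B) _ ⟩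
        BasisModTorsion.size C                     ∎
        where
        open ≡.≡-Reasoning
        B = proj₁ (bases S)
        C = proj₂ (bases S)

      -- Two counts of `Hom Γ/⟨ S ⟩ G`: one by the splitting into torsion and basis values, the
      -- other inside the enumeration of `Hom Γ G`.
      Hom-quotient-count : ∀ S → m S ℕ.* q ℕ.^ (r-Γ ∸ r S) ≡ count (λ i → holdsOn S (vanishes i))
      Hom-quotient-count S = ≡.trans
        (≡.cong (λ s → m S ℕ.* q ℕ.^ s) (corank S))
        (hasCardinality-unique
          (Composition.inverse
            (hasCardinality-× (m-card S) (hasCardinality-^ G↔q (BasisModTorsion.size C)))
            (Symmetry.inverse (Hom↔Hom-torsion×vec Γ/⟨ S ⟩ G C)))
          (Hom-quotient-hasCardinality S))
        where C = proj₂ (bases S)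

      ∣ℳ∣≡χ : ∀ {N} → HasCardinality ℳ N → + N ≡ χ I (+ q)
      ∣ℳ∣≡χ {N} ℳ↔N = begin
        + N
          ≡⟨ ≡.cong +_ (hasCardinality-unique ℳ↔N ℳ-hasCardinality) ⟩
        + count (λ i → holdsNowhere (vanishes i))
          ≡⟨ inclusion-exclusion vanishes ⟨
        ∑⊆ (λ S → sign S ℤ.* + count (λ i → holdsOn S (vanishes i)))
          ≡⟨ ∑⊆-cong term ⟩
        χ I (+ q) ∎
        where
        open ≡.≡-Reasoning
        term : ∀ S → sign S ℤ.* + count (λ i → holdsOn S (vanishes i)) ≡
                     sign S ℤ.* + m S ℤ.* (+ q) ℤ.^ (r-Γ ∸ r S)
        term S = begin
          sign S ℤ.* + count (λ i → holdsOn S (vanishes i))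
            ≡⟨ ≡.cong (λ c → sign S ℤ.* + c) (Hom-quotient-count S) ⟨
          sign S ℤ.* + (m S ℕ.* q ℕ.^ (r-Γ ∸ r S))
            ≡⟨ ≡.cong (sign S ℤ.*_) (ℤₚ.pos-* (m S) (q ℕ.^ (r-Γ ∸ r S))) ⟩
          sign S ℤ.* (+ m S ℤ.* + (q ℕ.^ (r-Γ ∸ r S)))
            ≡⟨ ≡.cong (λ c → sign S ℤ.* (+ m S ℤ.* c)) (pos-^ q (r-Γ ∸ r S)) ⟨
          sign S ℤ.* (+ m S ℤ.* (+ q) ℤ.^ (r-Γ ∸ r S))
            ≡⟨ ℤₚ.*-assoc (sign S) (+ m S) ((+ q) ℤ.^ (r-Γ ∸ r S)) ⟨
          sign S ℤ.* + m S ℤ.* (+ q) ℤ.^ (r-Γ ∸ r S) ∎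

    torsionHom-¬¬finite : (∀ S → BasisModTorsion Γ/⟨ S ⟩) →
                          ¬ ¬ (∀ S → ∃ λ k → HasCardinality (Hom (torsionSubgroup Γ/⟨ S ⟩) G) k)
    torsionHom-¬¬finite bases = ¬¬-∀⊆ λ S → ¬¬-finite (finite⇒injection
      (Composition.injection (Hom-torsion-injection Γ/⟨ S ⟩ G (bases S))
                             (Hom-quotient-injection Γ G (⟨⟩-isSubgroup S)))
      Hom↔h)

-- The second component shows that the first is not vacuous: it is contradictory that the invariants
-- and a cardinality of `ℳ` fail to exist.
mainTheorem10 : ∀ {a ℓ b ℓ′ : Level}
    (Γ : AbelianGroup a ℓ) → FinitelyGenerated Γ →
    (G : AbelianGroup b ℓ′) (q : ℕ) → HasCardinality (AbelianGroup.setoid G) q →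
    {n : ℕ} (𝒜 : Vector (AbelianGroup.Carrier Γ) n) →
    let open Arrangement Γ G 𝒜 in
    ((I : Invariants) (N : ℕ) → HasCardinality ℳ N → + N ≡ χ I (+ q))
    × ¬ ¬ (Invariants × ∃ λ N → HasCardinality ℳ N)
mainTheorem10 Γ fg G q G↔q 𝒜 =
  (λ I N ℳ↔N → decidable-stable (+ N ℤₚ.≟ χ I (+ q)) λ N≢χ →
    Hom-¬¬finite Γ G G↔q fg λ (h , Hom↔h) →
    bases-exist Γ fg G G↔q 𝒜 λ bases →
    N≢χ (∣ℳ∣≡χ Γ fg G G↔q 𝒜 Hom↔h bases I ℳ↔N)) ,
  λ none →
    Hom-¬¬finite Γ G G↔q fg λ (h , Hom↔h) →
    basis-exists Γ fg λ B →
    bases-exist Γ fg G G↔q 𝒜 λ bases →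
    torsionHom-¬¬finite Γ fg G G↔q 𝒜 Hom↔h (proj₂ ∘ bases) λ torsionHoms →
    none
      ( record
        { r-Γ      = BasisModTorsion.size B
        ; r        = λ S → BasisModTorsion.size (proj₁ (bases S))
        ; m        = λ S → proj₁ (torsionHoms S)
        ; r-Γ-rank = basis⇒hasRank Γ B
        ; r-rank   = λ S → basis⇒hasRank ⟨ S ⟩ (proj₁ (bases S))
        ; m-card   = λ S → proj₂ (torsionHoms S)
        }
      , _ , ℳ-hasCardinality Γ fg G G↔q 𝒜 Hom↔h )
  where open Arrangement Γ G 𝒜
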